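{- Let $\Omega$ be an extended diassociative semigroup (EDS), and $V$ a vector space over a field $\mathbb{K}$. For any $k,l\geq1$, any $\alpha_2,\ldots,\alpha_{k+l}\in\Omega$ and any $v_1,\ldots,v_{k+l}\in V$, in $\mathrm{Sh}^+_\Omega(V)$: $$(\alpha_2\ldots\alpha_k\otimes v_1\ldots v_k)\prec_{\alpha_{k+1}}(\alpha_{k+2}\ldots\alpha_{k+l}\otimes v_{k+1}\ldots v_{k+l})=\sum_{\sigma\in\mathbf{sh}_\prec(k,l)}D^{k,l}_\sigma(\alpha_2,\ldots,\alpha_{k+l})\otimes v_{\sigma^{ -1}(1)}\ldots v_{\sigma^{ -1}(k+l)},$$ $$(\alpha_2\ldots\alpha_k\otimes v_1\ldots v_k)\succ_{\alpha_{k+1}}(\alpha_{k+2}\ldots\alpha_{k+l}\otimes v_{k+1}\ldots v_{k+l})=\sum_{\sigma\in\mathbf{sh}_\succ(k,l)}D^{k,l}_\sigma(\alpha_2,\ldots,\alpha_{k+l})\otimes v_{\sigma^{ -1}(1)}\ldots v_{\sigma^{ -1}(k+l)}.$$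
   Context: Extended diassociative semigroups. A diassociative semigroup is a set $\Omega$ with maps $\leftarrow,\rightarrow:\Omega\times\Omega\to\Omega$ such that for all $\alpha,\beta,\gamma\in\Omega$: $(\alpha\leftarrow\beta)\leftarrow\gamma=\alpha\leftarrow(\beta\leftarrow\gamma)=\alpha\leftarrow(\beta\rightarrow\gamma)$; $(\alpha\rightarrow\beta)\leftarrow\gamma=\alpha\rightarrow(\beta\leftarrow\gamma)$; $(\alpha\rightarrow\beta)\rightarrow\gamma=(\alpha\leftarrow\beta)\rightarrow\gamma=\alpha\rightarrow(\beta\rightarrow\gamma)$. An extended diassociative semigroup (EDS) is $(\Omega,\leftarrow,\rightarrow,\triangleleft,\triangleright)$ such that $(\Omega,\leftarrow,\rightarrow)$ is a diassociative semigroup and for all $\alpha,\beta,\gamma\in\Omega$: $\alpha\triangleright(\beta\leftarrow\gamma)=\alpha\triangleright\beta$; $(\alpha\rightarrow\beta)\triangleleft\gamma=\beta\triangleleft\gamma$; $(\alpha\triangleleft\beta)\leftarrow((\alpha\leftarrow\beta)\triangleleft\gamma)=\alpha\triangleleft(\beta\leftarrow\gamma)$; $(\alpha\triangleleft\beta)\triangleleft((\alpha\leftarrow\beta)\triangleleft\gamma)=\beta\triangleleft\gamma$; $(\alpha\triangleleft\beta)\rightarrow((\alpha\leftarrow\beta)\triangleleft\gamma)=\alpha\triangleleft(\beta\rightarrow\gamma)$; $(\alpha\triangleleft\beta)\triangleright((\alpha\leftarrow\beta)\triangleleft\gamma)=\beta\triangleright\gamma$; $(\alpha\triangleright(\beta\rightarrow\gamma))\leftarrow(\beta\triangleright\gamma)=(\alpha\leftarrow\beta)\triangleright\gamma$;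 $(\alpha\triangleright(\beta\rightarrow\gamma))\triangleleft(\beta\triangleright\gamma)=\alpha\triangleleft\beta$; $(\alpha\triangleright(\beta\rightarrow\gamma))\rightarrow(\beta\triangleright\gamma)=(\alpha\rightarrow\beta)\triangleright\gamma$; $(\alpha\triangleright(\beta\rightarrow\gamma))\triangleright(\beta\triangleright\gamma)=\alpha\triangleright\beta$. Typed words. $\mathrm{Sh}^+_\Omega(V)=\bigoplus_{n\geq1}(\mathbb{K}\Omega)^{\otimes(n-1)}\otimes V^{\otimes n}$, spanned by typed words $\alpha_2\ldots\alpha_n\otimes v_1\ldots v_n$ (tuples in $\Omega^{n-1}$ are identified with tensors in $(\mathbb{K}\Omega)^{\otimes(n-1)}$). For $\alpha\in\Omega$, $v\in V$, put $(\alpha\otimes v)\cdot(\alpha_2\ldots\alpha_n\otimes v_1\ldots v_n)=\alpha\alpha_2\ldots\alpha_n\otimes vv_1\ldots v_n$. Each typed word of length $\ge2$ is of the form $(\beta\otimes v)\cdot x'$. The bilinear products are defined recursively, for typed words $x,y$ and $v,w\in V$, by: $v\prec_\alpha y=(\alpha\otimes v)\cdot y$; $x\succ_\alpha w=(\alpha\otimes w)\cdot x$; if $x=(\beta\otimes v)\cdot x'$, $x\prec_\alpha y=((\beta\leftarrow\alpha)\otimes v)\cdot(x'\prec_{\beta\triangleleft\alpha}y)+((\beta\rightarrow\alpha)\otimes v)\cdot(x'\succ_{\beta\triangleright\alpha}y)$; if $y=(\beta\otimes w)\cdot y'$, $x\succ_\alpha y=((\alpha\leftarrow\beta)\otimes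 w)\cdot(x\prec_{\alpha\triangleleft\beta}y')+((\alpha\rightarrow\beta)\otimes w)\cdot(x\succ_{\alpha\triangleright\beta}y')$. Shuffles. $\mathbf{sh}(k,l)$ is the set of $\sigma\in\mathfrak{S}_{k+l}$ with $\sigma(1)<\ldots<\sigma(k)$ and $\sigma(k+1)<\ldots<\sigma(k+l)$; $\mathbf{sh}_\prec(k,l)$ (resp. $\mathbf{sh}_\succ(k,l)$) is the subset where $\sigma^{ -1}(1)=1$ (resp. $\sigma^{ -1}(1)=k+1$), for $k,l\ge1$. Permutations are written as words $(\sigma(1),\ldots,\sigma(n))$. Maps $D^{k,l}_\sigma:\Omega^{k+l-1}\to\Omega^{k+l-1}$ for $\sigma\in\mathbf{sh}(k,l)$, $k,l\ge1$, defined recursively: (i) if $\sigma\in\mathbf{sh}_\prec(1,l)$, $D^{1,l}_\sigma(\alpha_2,\ldots,\alpha_{l+1})=(\alpha_2,\ldots,\alpha_{l+1})$. (ii) If $\sigma\in\mathbf{sh}_\prec(k,l)$, $k\geq2$, let $\sigma'=(\sigma(2)-1,\ldots,\sigma(k+l)-1)\in\mathbf{sh}(k-1,l)$; then $D^{k,l}_\sigma(\alpha_2,\ldots,\alpha_{k+l})$ is $(\alpha_2\leftarrow\alpha_{k+1},D^{k-1,l}_{\sigma'}(\alpha_3,\ldots,\alpha_k,\alpha_2\triangleleft\alpha_{k+1},\alpha_{k+2},\ldots,\alpha_{k+l}))$ if $\sigma'\in\mathbf{sh}_\prec(k-1,l)$, and $(\alpha_2\rightarrow\alpha_{k+1},D^{k-1,l}_{\sigma'}(\alpha_3,\ldots,\alpha_k,\alpha_2\triangleright\alpha_{k+1},\alpha_{k+2},\ldots,\alpha_{k+l}))$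 if $\sigma'\in\mathbf{sh}_\succ(k-1,l)$. (iii) If $\sigma\in\mathbf{sh}_\succ(k,1)$, $D^{k,1}_\sigma(\alpha_2,\ldots,\alpha_{k+1})=(\alpha_{k+1},\alpha_2,\ldots,\alpha_k)$. (iv) If $\sigma\in\mathbf{sh}_\succ(k,l)$, $l\ge2$, let $\sigma'=(\sigma(1)-1,\ldots,\sigma(k)-1,\sigma(k+2)-1,\ldots,\sigma(k+l)-1)\in\mathbf{sh}(k,l-1)$; then $D^{k,l}_\sigma(\alpha_2,\ldots,\alpha_{k+l})$ is $(\alpha_{k+1}\leftarrow\alpha_{k+2},D^{k,l-1}_{\sigma'}(\alpha_2,\ldots,\alpha_k,\alpha_{k+1}\triangleleft\alpha_{k+2},\alpha_{k+3},\ldots,\alpha_{k+l}))$ if $\sigma'\in\mathbf{sh}_\prec(k,l-1)$, and $(\alpha_{k+1}\rightarrow\alpha_{k+2},D^{k,l-1}_{\sigma'}(\alpha_2,\ldots,\alpha_k,\alpha_{k+1}\triangleright\alpha_{k+2},\alpha_{k+3},\ldots,\alpha_{k+l}))$ if $\sigma'\in\mathbf{sh}_\succ(k,l-1)$. -}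

module Defs where

open import Algebra.Apartness.Bundles using (HeytingCommutativeRing; HeytingField)
open import Algebra.Bundles using (CommutativeRing)
open import Algebra.Core using (Op₂)
open import Algebra.Definitions using (Congruent₂)
open import Algebra.Module.Bundles using (Module)
import Algebra.Properties.AbelianGroup as AbelianGroupProperties
import Algebra.Properties.Ring as RingProperties
open import Data.Bool.Base using (Bool; true; false; if_then_else_)
open import Data.Fin.Base as Fin using (Fin; zero; suc; _↑ˡ_; _↑ʳ_; punchIn)
open import Data.Fin.Permutation as Perm
  using (Permutation; Permutation′; _⟨$⟩ʳ_; _⟨$⟩ˡ_; _∘ₚ_; cast-id; insert; remove; insert-remove)
open import Data.Fin.Properties as Finₚ using (punchIn-injective)
open import Data.List.Base as List using (List; foldr; cartesianProduct; filter; allFin)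
import Data.List.Membership.Setoid as SetoidMembership
import Data.List.Membership.Setoid.Properties as SetoidMembershipₚ
open import Data.List.Membership.Propositional.Properties using (∈-allFin)
open import Data.List.Relation.Unary.All using ([])
open import Data.List.Relation.Unary.AllPairs using ([]; _∷_)
open import Data.List.Relation.Unary.Any using (here)
open import Data.List.Relation.Unary.Unique.Setoid using (Unique)
open import Data.List.Relation.Unary.Unique.Propositional.Properties using (allFin⁺)
import Data.List.Relation.Unary.Unique.Setoid.Properties as Uniqueₚ
open import Data.Nat.Base using (ℕ; zero; suc; _+_)
open import Data.Nat.Properties using (+-comm; +-suc)
open import Data.Product.Base using (_×_; _,_; uncurry)
open import Data.Product.Relation.Binary.Pointwise.NonDependent using (×-setoid)
open import Data.Vec.Base using (Vec; []; _∷_; cast; lookup; tabulate; _[_]≔_)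
open import Data.Vec.Relation.Binary.Pointwise.Inductive as Pointwise using (Pointwise; []; _∷_)
open import Function.Base using (_∘_)
open import Level using (Level; 0ℓ; _⊔_) renaming (suc to lsuc)
open import Relation.Binary.Bundles using (Setoid)
open import Relation.Binary.Core using (Rel; _Preserves_⟶_)
open import Relation.Binary.Structures using (IsEquivalence)
import Relation.Binary.PropositionalEquality as ≡
open ≡ using (_≡_)
import Relation.Binary.Reasoning.Setoid as SetoidReasoning
open import Relation.Nullary.Decidable using (Dec; does; map′; _×-dec_; _→-dec_)

private
  variable
    a ℓ : Level

-- The arrow → is reserved syntax, so ← and → are written ↼ and ⇀.

record IsDiassociativeSemigroup {A : Set a} (_≈_ : Rel A ℓ) (_↼_ _⇀_ : Op₂ A) : Set (a ⊔ ℓ) where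
  field
    isEquivalence : IsEquivalence _≈_
    ↼-cong        : Congruent₂ _≈_ _↼_
    ⇀-cong        : Congruent₂ _≈_ _⇀_
    ↼-assoc       : ∀ α β γ → ((α ↼ β) ↼ γ) ≈ (α ↼ (β ↼ γ))
    ↼-inner       : ∀ α β γ → (α ↼ (β ↼ γ)) ≈ (α ↼ (β ⇀ γ))
    ⇀-↼-assoc     : ∀ α β γ → ((α ⇀ β) ↼ γ) ≈ (α ⇀ (β ↼ γ))
    ⇀-inner       : ∀ α β γ → ((α ⇀ β) ⇀ γ) ≈ ((α ↼ β) ⇀ γ)
    ⇀-assoc       : ∀ α β γ → ((α ↼ β) ⇀ γ) ≈ (α ⇀ (β ⇀ γ))

  open IsEquivalence isEquivalence public

record IsExtendedDiassociativeSemigroup {A : Set a} (_≈_ : Rel A ℓ) (_↼_ _⇀_ _◁_ _▷_ : Op₂ A) : Set (a ⊔ ℓ) where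
  field
    isDiassociativeSemigroup : IsDiassociativeSemigroup _≈_ _↼_ _⇀_
    ◁-cong : Congruent₂ _≈_ _◁_
    ▷-cong : Congruent₂ _≈_ _▷_
    ▷-↼    : ∀ α β γ → (α ▷ (β ↼ γ)) ≈ (α ▷ β)
    ⇀-◁    : ∀ α β γ → ((α ⇀ β) ◁ γ) ≈ (β ◁ γ)
    ◁-↼-◁  : ∀ α β γ → ((α ◁ β) ↼ ((α ↼ β) ◁ γ)) ≈ (α ◁ (β ↼ γ))
    ◁-◁-◁  : ∀ α β γ → ((α ◁ β) ◁ ((α ↼ β) ◁ γ)) ≈ (β ◁ γ)
    ◁-⇀-◁  : ∀ α β γ → ((α ◁ β) ⇀ ((α ↼ β) ◁ γ)) ≈ (α ◁ (β ⇀ γ))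
    ◁-▷-◁  : ∀ α β γ → ((α ◁ β) ▷ ((α ↼ β) ◁ γ)) ≈ (β ▷ γ)
    ▷-↼-▷  : ∀ α β γ → ((α ▷ (β ⇀ γ)) ↼ (β ▷ γ)) ≈ ((α ↼ β) ▷ γ)
    ▷-◁-▷  : ∀ α β γ → ((α ▷ (β ⇀ γ)) ◁ (β ▷ γ)) ≈ (α ◁ β)
    ▷-⇀-▷  : ∀ α β γ → ((α ▷ (β ⇀ γ)) ⇀ (β ▷ γ)) ≈ ((α ⇀ β) ▷ γ)
    ▷-▷-▷  : ∀ α β γ → ((α ▷ (β ⇀ γ)) ▷ (β ▷ γ)) ≈ (α ▷ β)

  open IsDiassociativeSemigroup isDiassociativeSemigroup public

record ExtendedDiassociativeSemigroup a ℓ : Set (lsuc (a ⊔ ℓ)) where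
  infix  4 _≈_
  infixl 7 _↼_ _⇀_ _◁_ _▷_
  field
    Carrier : Set a
    _≈_     : Rel Carrier ℓ
    _↼_     : Op₂ Carrier
    _⇀_     : Op₂ Carrier
    _◁_     : Op₂ Carrier
    _▷_     : Op₂ Carrier
    isExtendedDiassociativeSemigroup : IsExtendedDiassociativeSemigroup _≈_ _↼_ _⇀_ _◁_ _▷_

  open IsExtendedDiassociativeSemigroup isExtendedDiassociativeSemigroup public

-- Every permutation, listed by its value at the first position.

permutations : ∀ n → List (Permutation′ n)
permutations zero    = Perm.id List.∷ List.[]
permutations (suc n) = List.map (uncurry (insert zero)) (cartesianProduct (allFin (suc n)) (permutations n))

Perm-setoid : ℕ → Setoid 0ℓ 0ℓ
Perm-setoid n = record
  { Carrier       = Permutation′ n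
  ; _≈_           = Perm._≈_
  ; isEquivalence = record
    { refl  = λ _ → ≡.refl
    ; sym   = λ p i → ≡.sym (p i)
    ; trans = λ p q i → ≡.trans (p i) (q i)
    }
  }

private
  Insertion-setoid : ℕ → Setoid 0ℓ 0ℓ
  Insertion-setoid n = ×-setoid (≡.setoid (Fin (suc n))) (Perm-setoid n)

  insert-cong : ∀ {n} → uncurry (insert zero) Preserves Setoid._≈_ (Insertion-setoid n) ⟶ Perm._≈_
  insert-cong (≡.refl , p) zero    = ≡.refl
  insert-cong {x = j , _} (≡.refl , p) (suc i) = ≡.cong (punchIn j) (p i)

  insert-injective : ∀ {n} {x y : Fin (suc n) × Permutation′ n} →
                     uncurry (insert zero) x Perm.≈ uncurry (insert zero) y →
                     Setoid._≈_ (Insertion-setoid n) x y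
  insert-injective {x = j , π} {y = k , ρ} p with p zero
  ... | ≡.refl = ≡.refl , λ i → punchIn-injective j _ _ (p (suc i))

permutations-complete : ∀ {n} (π : Permutation′ n) → SetoidMembership._∈_ (Perm-setoid n) π (permutations n)
permutations-complete {zero}  π = here λ ()
permutations-complete {suc n} π =
  ∈-resp-≈ (Perm-setoid (suc n)) {x = insert zero j ρ} {y = π} (insert-remove zero π)
    (∈-map⁺ (Insertion-setoid n) (Perm-setoid (suc n)) (λ {x} {y} → insert-cong {x = x} {y})
      (∈-cartesianProduct⁺ (≡.setoid _) (Perm-setoid n) {x = j} {y = ρ}
        (∈-allFin j) (permutations-complete ρ)))
  where
  open SetoidMembershipₚ using (∈-resp-≈; ∈-map⁺; ∈-cartesianProduct⁺)
  j = π ⟨$⟩ʳ zero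
  ρ = remove zero π

permutations-unique : ∀ n → Unique (Perm-setoid n) (permutations n)
permutations-unique zero    = [] ∷ []
permutations-unique (suc n) =
  Uniqueₚ.map⁺ (Insertion-setoid n) (Perm-setoid (suc n)) (λ {x} {y} → insert-injective {x = x} {y})
    (Uniqueₚ.cartesianProduct⁺ (≡.setoid _) (Perm-setoid n) (allFin⁺ (suc n)) (permutations-unique n))

IsShuffle : ∀ k l → Permutation′ (k + l) → Set
IsShuffle k l σ =
  (λ i → σ ⟨$⟩ʳ (i ↑ˡ l)) Preserves Fin._<_ ⟶ Fin._<_ ×
  (λ j → σ ⟨$⟩ʳ (k ↑ʳ j)) Preserves Fin._<_ ⟶ Fin._<_

private
  increasing? : ∀ {m n} (f : Fin m → Fin n) → Dec (f Preserves Fin._<_ ⟶ Fin._<_)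
  increasing? f = map′ (λ p {i} {j} → p i j) (λ p i j → p)
    (Finₚ.all? λ i → Finₚ.all? λ j → (i Finₚ.<? j) →-dec (f i Finₚ.<? f j))

isShuffle? : ∀ k l σ → Dec (IsShuffle k l σ)
isShuffle? k l σ = increasing? _ ×-dec increasing? _

-- From here on both block lengths are positive: k = suc m and l = suc n.
-- Positions are numbered from zero, so position 1 is zero and position
-- k + 1 is suc m ↑ʳ zero.

IsShuffle≺ IsShuffle≻ : ∀ m n → Permutation′ (suc m + suc n) → Set
IsShuffle≺ m n σ = IsShuffle (suc m) (suc n) σ × σ ⟨$⟩ˡ zero ≡ zero
IsShuffle≻ m n σ = IsShuffle (suc m) (suc n) σ × σ ⟨$⟩ˡ zero ≡ suc m ↑ʳ zero

isShuffle≺? : ∀ m n σ → Dec (IsShuffle≺ m n σ)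
isShuffle≺? m n σ = isShuffle? (suc m) (suc n) σ ×-dec (σ ⟨$⟩ˡ zero Finₚ.≟ zero)

isShuffle≻? : ∀ m n σ → Dec (IsShuffle≻ m n σ)
isShuffle≻? m n σ = isShuffle? (suc m) (suc n) σ ×-dec (σ ⟨$⟩ˡ zero Finₚ.≟ suc m ↑ʳ zero)

sh≺ sh≻ : ∀ m n → List (Permutation′ (suc m + suc n))
sh≺ m n = filter (isShuffle≺? m n) (permutations (suc m + suc n))
sh≻ m n = filter (isShuffle≻? m n) (permutations (suc m + suc n))

-- remove i σ deletes the i-th letter of the word of σ and renumbers the
-- others.  In both uses below the deleted letter is the smallest one, so
-- renumbering subtracts 1 from each remaining letter.

dropˡ : ∀ m n → Permutation′ (suc (suc m) + suc n) → Permutation′ (suc m + suc n)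
dropˡ m n σ = remove zero σ

dropʳ : ∀ m n → Permutation′ (suc m + suc (suc n)) → Permutation′ (suc m + suc n)
dropʳ m n σ = cast-id (≡.sym eq) ∘ₚ remove (suc m ↑ʳ zero) σ ∘ₚ cast-id eq
  where eq = +-suc m (suc n)

-- (v_{σ⁻¹(1)}, …, v_{σ⁻¹(n)})

permute : ∀ {A : Set a} {n} → Permutation′ n → Vec A n → Vec A n
permute σ vs = tabulate λ i → lookup vs (σ ⟨$⟩ˡ i)

module Decorations {a ℓ} (Ω : ExtendedDiassociativeSemigroup a ℓ) where
  open ExtendedDiassociativeSemigroup Ω

  -- D m n σ (α₂ … αₖ) αₖ₊₁ (αₖ₊₂ … αₖ₊ₗ), with k = suc m and l = suc n.
  --
  -- A (k,l)-shuffle lies in sh≺ if σ⁻¹(1) = 1 and in sh≻ otherwise, so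
  -- testing σ⁻¹(1) separates the cases.  For uniformity D is defined on
  -- all permutations; its values outside sh(k,l) have no meaning.

  starts≺ : ∀ m n → Permutation′ (suc m + suc n) → Bool
  starts≺ m n σ = does (σ ⟨$⟩ˡ zero Finₚ.≟ zero)

  D  : ∀ m n → Permutation′ (suc m + suc n) → Vec Carrier m → Carrier → Vec Carrier n → Vec Carrier (m + suc n)
  D≺ : ∀ m n → Permutation′ (suc m + suc n) → Vec Carrier m → Carrier → Vec Carrier n → Vec Carrier (m + suc n)
  D≻ : ∀ m n → Permutation′ (suc m + suc n) → Vec Carrier m → Carrier → Vec Carrier n → Vec Carrier (m + suc n)

  D m n σ αs α βs = if starts≺ m n σ then D≺ m n σ αs α βs else D≻ m n σ αs α βs

  D≺ zero    n σ []       α βs = α ∷ βs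
  D≺ (suc m) n σ (β ∷ αs) α βs =
    if starts≺ m n σ′
      then (β ↼ α) ∷ D m n σ′ αs (β ◁ α) βs
      else (β ⇀ α) ∷ D m n σ′ αs (β ▷ α) βs
    where σ′ = dropˡ m n σ

  D≻ m zero    σ αs α []       = cast (+-comm 1 m) (α ∷ αs)
  D≻ m (suc n) σ αs α (β ∷ βs) = cast (≡.sym (+-suc m (suc n)))
    (if starts≺ m n σ′
      then (α ↼ β) ∷ D m n σ′ αs (α ◁ β) βs
      else (α ⇀ β) ∷ D m n σ′ αs (α ▷ β) βs)
    where σ′ = dropʳ m n σ

VectorSpace : ∀ {c ℓ₁ ℓ₂} → HeytingField c ℓ₁ ℓ₂ → ∀ v ℓv → Set _
VectorSpace K = Module (HeytingCommutativeRing.commutativeRing (HeytingField.heytingCommutativeRing K))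

module TypedWords
  {c ℓ₁ ℓ₂ v ℓv o ℓo}
  (K : HeytingField c ℓ₁ ℓ₂)
  (V : VectorSpace K v ℓv)
  (Ω : ExtendedDiassociativeSemigroup o ℓo)
  where

  private
    ring = HeytingCommutativeRing.commutativeRing (HeytingField.heytingCommutativeRing K)
    module K = CommutativeRing ring
    module V = Module V
    module Ω = ExtendedDiassociativeSemigroup Ω
    variable
      m n : ℕ

  open Ω using (_↼_; _⇀_; _◁_; _▷_)
  open V using (_+ᴹ_; _*ₗ_)

  -- Since (𝕂Ω)^{⊗(n-1)} is free on Ωⁿ⁻¹, the direct sum of the
  -- (𝕂Ω)^{⊗(n-1)} ⊗ V^{⊗n} over n ≥ 1 is presented by the typed words
  -- α₂…αₙ ⊗ v₁…vₙ as generators, with linearity in each vᵢ as relations: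
  -- its elements are linear combinations of typed words, compared by ≋.

  infixl 6 _⊕_
  infixr 7 _⊙_
  infix  8 _⊗_
  infix  4 _≋_

  data Combination : Set (c ⊔ v ⊔ o) where
    _⊗_ : Vec Ω.Carrier n → Vec V.Carrierᴹ (suc n) → Combination
    𝟘   : Combination
    _⊕_ : Combination → Combination → Combination
    _⊙_ : K.Carrier → Combination → Combination

  data _≋_ : Rel Combination (c ⊔ ℓ₁ ⊔ v ⊔ ℓv ⊔ o ⊔ ℓo) where
    ≋-refl        : ∀ {x} → x ≋ x
    ≋-sym         : ∀ {x y} → x ≋ y → y ≋ x
    ≋-trans       : ∀ {x y z} → x ≋ y → y ≋ z → x ≋ z
    ⊕-cong        : ∀ {x x′ y y′} → x ≋ x′ → y ≋ y′ → x ⊕ y ≋ x′ ⊕ y′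
    ⊙-cong        : ∀ {a a′ x x′} → a K.≈ a′ → x ≋ x′ → a ⊙ x ≋ a′ ⊙ x′
    ⊕-assoc       : ∀ x y z → (x ⊕ y) ⊕ z ≋ x ⊕ (y ⊕ z)
    ⊕-comm        : ∀ x y → x ⊕ y ≋ y ⊕ x
    ⊕-identityˡ   : ∀ x → 𝟘 ⊕ x ≋ x
    ⊙-zeroˡ       : ∀ x → K.0# ⊙ x ≋ 𝟘
    ⊙-identityˡ   : ∀ x → K.1# ⊙ x ≋ x
    ⊙-assoc       : ∀ a b x → (a K.* b) ⊙ x ≋ a ⊙ (b ⊙ x)
    ⊙-distribˡ    : ∀ a x y → a ⊙ (x ⊕ y) ≋ a ⊙ x ⊕ a ⊙ y
    ⊙-distribʳ    : ∀ a b x → (a K.+ b) ⊙ x ≋ a ⊙ x ⊕ b ⊙ x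
    ⊗-cong        : {αs βs : Vec Ω.Carrier n} {vs ws : Vec V.Carrierᴹ (suc n)} →
                    Pointwise Ω._≈_ αs βs → Pointwise V._≈ᴹ_ vs ws → αs ⊗ vs ≋ βs ⊗ ws
    ⊗-linear      : (αs : Vec Ω.Carrier n) (vs : Vec V.Carrierᴹ (suc n)) (i : Fin (suc n)) →
                    ∀ a u w → αs ⊗ (vs [ i ]≔ (a *ₗ u +ᴹ w)) ≋ a ⊙ (αs ⊗ (vs [ i ]≔ u)) ⊕ αs ⊗ (vs [ i ]≔ w)

  ≋-setoid : Setoid _ _
  ≋-setoid = record
    { _≈_           = _≋_
    ; isEquivalence = record { refl = ≋-refl ; sym = ≋-sym ; trans = ≋-trans }
    }

  open SetoidReasoning ≋-setoid

  private
    ⊕-identityʳ : ∀ x → x ⊕ 𝟘 ≋ x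
    ⊕-identityʳ x = ≋-trans (⊕-comm x 𝟘) (⊕-identityˡ x)

    ⊙-zeroʳ : ∀ a → a ⊙ 𝟘 ≋ 𝟘
    ⊙-zeroʳ a = begin
      a ⊙ 𝟘             ≈⟨ ⊙-cong K.refl (⊙-zeroˡ 𝟘) ⟨
      a ⊙ (K.0# ⊙ 𝟘)    ≈⟨ ⊙-assoc a K.0# 𝟘 ⟨
      (a K.* K.0#) ⊙ 𝟘  ≈⟨ ⊙-cong (K.zeroʳ a) ≋-refl ⟩
      K.0# ⊙ 𝟘          ≈⟨ ⊙-zeroˡ 𝟘 ⟩
      𝟘                 ∎

    ⊖_ : Combination → Combination
    ⊖ x = (K.- K.1#) ⊙ x

    ⊖-inverseˡ : ∀ x → ⊖ x ⊕ x ≋ 𝟘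
    ⊖-inverseˡ x = begin
      ⊖ x ⊕ x                       ≈⟨ ⊕-cong ≋-refl (⊙-identityˡ x) ⟨
      ⊖ x ⊕ K.1# ⊙ x                ≈⟨ ⊙-distribʳ _ _ x ⟨
      (K.- K.1# K.+ K.1#) ⊙ x       ≈⟨ ⊙-cong (K.-‿inverseˡ K.1#) ≋-refl ⟩
      K.0# ⊙ x                      ≈⟨ ⊙-zeroˡ x ⟩
      𝟘                             ∎

    ⊙-comm : ∀ a b x → a ⊙ (b ⊙ x) ≋ b ⊙ (a ⊙ x)
    ⊙-comm a b x = begin
      a ⊙ (b ⊙ x)    ≈⟨ ⊙-assoc a b x ⟨
      (a K.* b) ⊙ x  ≈⟨ ⊙-cong (K.*-comm a b) ≋-refl ⟩
      (b K.* a) ⊙ x  ≈⟨ ⊙-assoc b a x ⟩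
      b ⊙ (a ⊙ x)    ∎

  Sh⁺ : VectorSpace K (c ⊔ v ⊔ o) (c ⊔ ℓ₁ ⊔ v ⊔ ℓv ⊔ o ⊔ ℓo)
  Sh⁺ = record
    { Carrierᴹ = Combination
    ; _≈ᴹ_     = _≋_
    ; _+ᴹ_     = _⊕_
    ; _*ₗ_     = _⊙_
    ; _*ᵣ_     = λ x a → a ⊙ x
    ; 0ᴹ       = 𝟘
    ; -ᴹ_      = ⊖_
    ; isModule = record
      { isBimodule = record
        { isBisemimodule = record
          { +ᴹ-isCommutativeMonoid = record
            { isMonoid = record
              { isSemigroup = record
                { isMagma = record
                  { isEquivalence = Setoid.isEquivalence ≋-setoid
                  ; ∙-cong        = ⊕-cong
                  }
                ; assoc = ⊕-assoc
                }
              ; identity = ⊕-identityˡ , ⊕-identityʳ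
              }
            ; comm = ⊕-comm
            }
          ; isPreleftSemimodule = record
            { *ₗ-cong      = ⊙-cong
            ; *ₗ-zeroˡ     = ⊙-zeroˡ
            ; *ₗ-distribʳ  = λ x a b → ⊙-distribʳ a b x
            ; *ₗ-identityˡ = ⊙-identityˡ
            ; *ₗ-assoc     = ⊙-assoc
            ; *ₗ-zeroʳ     = ⊙-zeroʳ
            ; *ₗ-distribˡ  = ⊙-distribˡ
            }
          ; isPrerightSemimodule = record
            { *ᵣ-cong      = λ p q → ⊙-cong q p
            ; *ᵣ-zeroʳ     = ⊙-zeroˡ
            ; *ᵣ-distribˡ  = λ x a b → ⊙-distribʳ a b x
            ; *ᵣ-identityʳ = ⊙-identityˡ
            ; *ᵣ-assoc     = λ x a b → ≋-trans (⊙-comm b a x) (≋-sym (⊙-assoc a b x))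
            ; *ᵣ-zeroˡ     = ⊙-zeroʳ
            ; *ᵣ-distribʳ  = λ a x y → ⊙-distribˡ a x y
            }
          ; *ₗ-*ᵣ-assoc = λ a x b → ⊙-comm b a x
          }
        ; -ᴹ‿cong    = ⊙-cong K.refl
        ; -ᴹ‿inverse = ⊖-inverseˡ , λ x → ≋-trans (⊕-comm x (⊖ x)) (⊖-inverseˡ x)
        }
      ; *ₗ-*ᵣ-coincident = λ a x → ≋-refl
      }
    }

  ∑ : ∀ {A : Set a} → List A → (A → Combination) → Combination
  ∑ xs f = foldr _⊕_ 𝟘 (List.map f xs)

  infix 5 ∑
  syntax ∑ xs (λ x → e) = ∑[ x ∈ xs ] e

  extend : (∀ {n} → Vec Ω.Carrier n → Vec V.Carrierᴹ (suc n) → Combination) → Combination → Combination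
  extend f (αs ⊗ vs) = f αs vs
  extend f 𝟘         = 𝟘
  extend f (x ⊕ y)   = extend f x ⊕ extend f y
  extend f (a ⊙ x)   = a ⊙ extend f x

  -- ⟨ α ∣ v ⟩· x is (α ⊗ v) · x.

  infixr 8 ⟨_∣_⟩·_

  ⟨_∣_⟩·_ : Ω.Carrier → V.Carrierᴹ → Combination → Combination
  ⟨ α ∣ v ⟩· x = extend (λ αs vs → (α ∷ αs) ⊗ (v ∷ vs)) x

  prec succ : Vec Ω.Carrier m → Vec V.Carrierᴹ (suc m) → Ω.Carrier →
              Vec Ω.Carrier n → Vec V.Carrierᴹ (suc n) → Combination
  prec []       (v ∷ []) α βs ws = (α ∷ βs) ⊗ (v ∷ ws)
  prec (β ∷ αs) (v ∷ vs) α βs ws =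
    ⟨ β ↼ α ∣ v ⟩· prec αs vs (β ◁ α) βs ws ⊕ ⟨ β ⇀ α ∣ v ⟩· succ αs vs (β ▷ α) βs ws
  succ αs vs α []       (w ∷ []) = (α ∷ αs) ⊗ (w ∷ vs)
  succ αs vs α (β ∷ βs) (w ∷ ws) =
    ⟨ α ↼ β ∣ w ⟩· prec αs vs (α ◁ β) βs ws ⊕ ⟨ α ⇀ β ∣ w ⟩· succ αs vs (α ▷ β) βs ws

  infix 5 _≺[_]_ _≻[_]_

  _≺[_]_ _≻[_]_ : Combination → Ω.Carrier → Combination → Combination
  x ≺[ α ] y = extend (λ αs vs → extend (λ βs ws → prec αs vs α βs ws) y) x
  x ≻[ α ] y = extend (λ αs vs → extend (λ βs ws → succ αs vs α βs ws) y) x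

  -- The products respect ≋, so they are well defined on Sh⁺.

  private
    record IsMultilinear (f : ∀ {n} → Vec Ω.Carrier n → Vec V.Carrierᴹ (suc n) → Combination)
                         : Set (c ⊔ ℓ₁ ⊔ v ⊔ ℓv ⊔ o ⊔ ℓo) where
      field
        cong   : {αs βs : Vec Ω.Carrier n} {vs ws : Vec V.Carrierᴹ (suc n)} →
                 Pointwise Ω._≈_ αs βs → Pointwise V._≈ᴹ_ vs ws → f αs vs ≋ f βs ws
        linear : (αs : Vec Ω.Carrier n) (vs : Vec V.Carrierᴹ (suc n)) (i : Fin (suc n)) → ∀ a u w →
                 f αs (vs [ i ]≔ (a *ₗ u +ᴹ w)) ≋ a ⊙ f αs (vs [ i ]≔ u) ⊕ f αs (vs [ i ]≔ w)

    reflΩ : {αs : Vec Ω.Carrier n} → Pointwise Ω._≈_ αs αs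
    reflΩ = Pointwise.refl Ω.refl

    reflV : {vs : Vec V.Carrierᴹ n} → Pointwise V._≈ᴹ_ vs vs
    reflV = Pointwise.refl V.≈ᴹ-refl

    module _ {f : ∀ {n} → Vec Ω.Carrier n → Vec V.Carrierᴹ (suc n) → Combination} (F : IsMultilinear f) where
      open IsMultilinear F

      extend-cong : ∀ {x y} → x ≋ y → extend f x ≋ extend f y
      extend-cong ≋-refl                     = ≋-refl
      extend-cong (≋-sym p)                  = ≋-sym (extend-cong p)
      extend-cong (≋-trans p q)              = ≋-trans (extend-cong p) (extend-cong q)
      extend-cong (⊕-cong p q)               = ⊕-cong (extend-cong p) (extend-cong q)
      extend-cong (⊙-cong p q)               = ⊙-cong p (extend-cong q)
      extend-cong (⊕-assoc x y z)            = ⊕-assoc _ _ _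
      extend-cong (⊕-comm x y)               = ⊕-comm _ _
      extend-cong (⊕-identityˡ x)            = ⊕-identityˡ _
      extend-cong (⊙-zeroˡ x)                = ⊙-zeroˡ _
      extend-cong (⊙-identityˡ x)            = ⊙-identityˡ _
      extend-cong (⊙-assoc a b x)            = ⊙-assoc a b _
      extend-cong (⊙-distribˡ a x y)         = ⊙-distribˡ a _ _
      extend-cong (⊙-distribʳ a b x)         = ⊙-distribʳ a b _
      extend-cong (⊗-cong p q)               = cong p q
      extend-cong (⊗-linear αs vs i a u w)   = linear αs vs i a u w

    module _ {f g : ∀ {n} → Vec Ω.Carrier n → Vec V.Carrierᴹ (suc n) → Combination} where

      extend-pointwise : (∀ {n} (αs : Vec Ω.Carrier n) vs → f αs vs ≋ g αs vs) → ∀ x → extend f x ≋ extend g x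
      extend-pointwise p (αs ⊗ vs) = p αs vs
      extend-pointwise p 𝟘         = ≋-refl
      extend-pointwise p (x ⊕ y)   = ⊕-cong (extend-pointwise p x) (extend-pointwise p y)
      extend-pointwise p (a ⊙ x)   = ⊙-cong K.refl (extend-pointwise p x)

    interchange : ∀ a x y z w → (a ⊙ x ⊕ y) ⊕ (a ⊙ z ⊕ w) ≋ a ⊙ (x ⊕ z) ⊕ (y ⊕ w)
    interchange a x y z w = begin
      (a ⊙ x ⊕ y) ⊕ (a ⊙ z ⊕ w)  ≈⟨ ⊕-assoc _ _ _ ⟩
      a ⊙ x ⊕ (y ⊕ (a ⊙ z ⊕ w))  ≈⟨ ⊕-cong ≋-refl (⊕-assoc _ _ _) ⟨
      a ⊙ x ⊕ ((y ⊕ a ⊙ z) ⊕ w)  ≈⟨ ⊕-cong ≋-refl (⊕-cong (⊕-comm _ _) ≋-refl) ⟩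
      a ⊙ x ⊕ ((a ⊙ z ⊕ y) ⊕ w)  ≈⟨ ⊕-cong ≋-refl (⊕-assoc _ _ _) ⟩
      a ⊙ x ⊕ (a ⊙ z ⊕ (y ⊕ w))  ≈⟨ ⊕-assoc _ _ _ ⟨
      (a ⊙ x ⊕ a ⊙ z) ⊕ (y ⊕ w)  ≈⟨ ⊕-cong (⊙-distribˡ a x z) ≋-refl ⟨
      a ⊙ (x ⊕ z) ⊕ (y ⊕ w)      ∎

    module _ {f g h : ∀ {n} → Vec Ω.Carrier n → Vec V.Carrierᴹ (suc n) → Combination} (a : K.Carrier)
             (p : ∀ {n} (αs : Vec Ω.Carrier n) vs → f αs vs ≋ a ⊙ g αs vs ⊕ h αs vs) where

      extend-linear : ∀ x → extend f x ≋ a ⊙ extend g x ⊕ extend h x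
      extend-linear (αs ⊗ vs) = p αs vs
      extend-linear 𝟘         = ≋-sym (≋-trans (⊕-identityʳ _) (⊙-zeroʳ a))
      extend-linear (x ⊕ y)   = ≋-trans (⊕-cong (extend-linear x) (extend-linear y)) (interchange a _ _ _ _)
      extend-linear (b ⊙ x)   = ≋-trans (⊙-cong K.refl (extend-linear x))
                               (≋-trans (⊙-distribˡ b _ _) (⊕-cong (⊙-comm b a _) ≋-refl))

    ⟨∣⟩·-cong : ∀ {α β v w x y} → α Ω.≈ β → v V.≈ᴹ w → x ≋ y → ⟨ α ∣ v ⟩· x ≋ ⟨ β ∣ w ⟩· y
    ⟨∣⟩·-cong {x = x} p q r = ≋-trans
      (extend-pointwise (λ _ _ → ⊗-cong (p ∷ reflΩ) (q ∷ reflV)) x)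
      (extend-cong record
        { cong   = λ s t → ⊗-cong (Ω.refl ∷ s) (V.≈ᴹ-refl ∷ t)
        ; linear = λ αs vs i → ⊗-linear (_ ∷ αs) (_ ∷ vs) (suc i)
        } r)

    ⟨∣⟩·-linear : ∀ α x a u w → ⟨ α ∣ a *ₗ u +ᴹ w ⟩· x ≋ a ⊙ ⟨ α ∣ u ⟩· x ⊕ ⟨ α ∣ w ⟩· x
    ⟨∣⟩·-linear α x a u w = extend-linear a (λ αs vs → ⊗-linear (α ∷ αs) (u ∷ vs) zero a u w) x

    Prec-cong : (∀ {m n} → Vec Ω.Carrier m → Vec V.Carrierᴹ (suc m) → Ω.Carrier →
                 Vec Ω.Carrier n → Vec V.Carrierᴹ (suc n) → Combination) → Set _
    Prec-cong f = ∀ {m n} {αs αs′ : Vec Ω.Carrier m} {vs vs′ α α′} {βs βs′ : Vec Ω.Carrier n} {ws ws′} →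
      Pointwise Ω._≈_ αs αs′ → Pointwise V._≈ᴹ_ vs vs′ → α Ω.≈ α′ →
      Pointwise Ω._≈_ βs βs′ → Pointwise V._≈ᴹ_ ws ws′ → f αs vs α βs ws ≋ f αs′ vs′ α′ βs′ ws′

    prec-cong : Prec-cong prec
    succ-cong : Prec-cong succ
    prec-cong []       (q ∷ []) r s t = ⊗-cong (r ∷ s) (q ∷ t)
    prec-cong (p ∷ ps) (q ∷ qs) r s t = ⊕-cong
      (⟨∣⟩·-cong (Ω.↼-cong p r) q (prec-cong ps qs (Ω.◁-cong p r) s t))
      (⟨∣⟩·-cong (Ω.⇀-cong p r) q (succ-cong ps qs (Ω.▷-cong p r) s t))
    succ-cong p q r []       (t ∷ []) = ⊗-cong (r ∷ p) (t ∷ q)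
    succ-cong p q r (s ∷ ss) (t ∷ ts) = ⊕-cong
      (⟨∣⟩·-cong (Ω.↼-cong r s) t (prec-cong p q (Ω.◁-cong r s) ss ts))
      (⟨∣⟩·-cong (Ω.⇀-cong r s) t (succ-cong p q (Ω.▷-cong r s) ss ts))

    module _ (a : K.Carrier) (u w : V.Carrierᴹ) where
      both : ∀ {α β t X Y Z X′ Y′ Z′} → X ≋ a ⊙ Y ⊕ Z → X′ ≋ a ⊙ Y′ ⊕ Z′ →
             ⟨ α ∣ t ⟩· X ⊕ ⟨ β ∣ t ⟩· X′ ≋
             a ⊙ (⟨ α ∣ t ⟩· Y ⊕ ⟨ β ∣ t ⟩· Y′) ⊕ (⟨ α ∣ t ⟩· Z ⊕ ⟨ β ∣ t ⟩· Z′)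
      both p q = ≋-trans
        (⊕-cong (⟨∣⟩·-cong Ω.refl V.≈ᴹ-refl p) (⟨∣⟩·-cong Ω.refl V.≈ᴹ-refl q))
        (interchange a _ _ _ _)

      prec-linearˡ : ∀ (αs : Vec Ω.Carrier m) vs i α (βs : Vec Ω.Carrier n) ws →
        prec αs (vs [ i ]≔ (a *ₗ u +ᴹ w)) α βs ws ≋
        a ⊙ prec αs (vs [ i ]≔ u) α βs ws ⊕ prec αs (vs [ i ]≔ w) α βs ws
      succ-linearˡ : ∀ (αs : Vec Ω.Carrier m) vs i α (βs : Vec Ω.Carrier n) ws →
        succ αs (vs [ i ]≔ (a *ₗ u +ᴹ w)) α βs ws ≋
        a ⊙ succ αs (vs [ i ]≔ u) α βs ws ⊕ succ αs (vs [ i ]≔ w) α βs ws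
      prec-linearˡ []       (v ∷ []) zero    α βs ws = ⊗-linear (α ∷ βs) (v ∷ ws) zero a u w
      prec-linearˡ (β ∷ αs) (v ∷ vs) zero    α βs ws = ≋-trans
        (⊕-cong (⟨∣⟩·-linear _ (prec αs vs (β ◁ α) βs ws) a u w) (⟨∣⟩·-linear _ (succ αs vs (β ▷ α) βs ws) a u w))
        (interchange a _ _ _ _)
      prec-linearˡ (β ∷ αs) (v ∷ vs) (suc i) α βs ws =
        both (prec-linearˡ αs vs i (β ◁ α) βs ws) (succ-linearˡ αs vs i (β ▷ α) βs ws)
      succ-linearˡ αs vs i α []       (x ∷ []) = ⊗-linear (α ∷ αs) (x ∷ vs) (suc i) a u w
      succ-linearˡ αs vs i α (β ∷ βs) (x ∷ ws) =
        both (prec-linearˡ αs vs i (α ◁ β) βs ws) (succ-linearˡ αs vs i (α ▷ β) βs ws)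

      prec-linearʳ : ∀ (αs : Vec Ω.Carrier m) vs α (βs : Vec Ω.Carrier n) ws i →
        prec αs vs α βs (ws [ i ]≔ (a *ₗ u +ᴹ w)) ≋
        a ⊙ prec αs vs α βs (ws [ i ]≔ u) ⊕ prec αs vs α βs (ws [ i ]≔ w)
      succ-linearʳ : ∀ (αs : Vec Ω.Carrier m) vs α (βs : Vec Ω.Carrier n) ws i →
        succ αs vs α βs (ws [ i ]≔ (a *ₗ u +ᴹ w)) ≋
        a ⊙ succ αs vs α βs (ws [ i ]≔ u) ⊕ succ αs vs α βs (ws [ i ]≔ w)
      prec-linearʳ []       (v ∷ []) α βs ws i = ⊗-linear (α ∷ βs) (v ∷ ws) (suc i) a u w
      prec-linearʳ (β ∷ αs) (v ∷ vs) α βs ws i =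
        both (prec-linearʳ αs vs (β ◁ α) βs ws i) (succ-linearʳ αs vs (β ▷ α) βs ws i)
      succ-linearʳ αs vs α []       (x ∷ []) zero    = ⊗-linear (α ∷ αs) (x ∷ vs) zero a u w
      succ-linearʳ αs vs α (β ∷ βs) (x ∷ ws) zero    = ≋-trans
        (⊕-cong (⟨∣⟩·-linear _ (prec αs vs (α ◁ β) βs ws) a u w) (⟨∣⟩·-linear _ (succ αs vs (α ▷ β) βs ws) a u w))
        (interchange a _ _ _ _)
      succ-linearʳ αs vs α (β ∷ βs) (x ∷ ws) (suc i) =
        both (prec-linearʳ αs vs (α ◁ β) βs ws i) (succ-linearʳ αs vs (α ▷ β) βs ws i)

  ≺-cong : ∀ {x x′ α α′ y y′} → x ≋ x′ → α Ω.≈ α′ → y ≋ y′ → (x ≺[ α ] y) ≋ (x′ ≺[ α′ ] y′)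
  ≺-cong {x} {x′} {α} {α′} {y} {y′} p q r = ≋-trans
    (extend-pointwise (λ αs vs → ≋-trans
      (extend-pointwise (λ βs ws → prec-cong reflΩ reflV q reflΩ reflV) y)
      (extend-cong record
        { cong   = prec-cong reflΩ reflV Ω.refl
        ; linear = λ βs ws i a u w → prec-linearʳ a u w αs vs α′ βs ws i
        } r)) x)
    (extend-cong record
      { cong   = λ s t → extend-pointwise (λ βs ws → prec-cong s t Ω.refl reflΩ reflV) y′
      ; linear = λ αs vs i a u w → extend-linear a (λ βs ws → prec-linearˡ a u w αs vs i α′ βs ws) y′
      } p)

  ≻-cong : ∀ {x x′ α α′ y y′} → x ≋ x′ → α Ω.≈ α′ → y ≋ y′ → (x ≻[ α ] y) ≋ (x′ ≻[ α′ ] y′)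
  ≻-cong {x} {x′} {α} {α′} {y} {y′} p q r = ≋-trans
    (extend-pointwise (λ αs vs → ≋-trans
      (extend-pointwise (λ βs ws → succ-cong reflΩ reflV q reflΩ reflV) y)
      (extend-cong record
        { cong   = succ-cong reflΩ reflV Ω.refl
        ; linear = λ βs ws i a u w → succ-linearʳ a u w αs vs α′ βs ws i
        } r)) x)
    (extend-cong record
      { cong   = λ s t → extend-pointwise (λ βs ws → succ-cong s t Ω.refl reflΩ reflV) y′
      ; linear = λ αs vs i a u w → extend-linear a (λ βs ws → succ-linearˡ a u w αs vs i α′ βs ws) y′
      } p)

  open Decorations Ω public using (D)

{-# OPTIONS --safe #-}
module Submission where

open import Defs
open import Algebra.Apartness.Bundles using (HeytingField)
open import Algebra.Module.Bundles using (Module)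
open import Data.Bool.Base using (true; false; if_then_else_)
open import Data.Bool.Properties using (if-cong; if-cong₂; if-float)
open import Data.Fin.Base as Fin using (Fin; zero; suc; toℕ; _↑ˡ_; _↑ʳ_; punchIn; splitAt)
open import Data.Fin.Permutation as Perm
  using (Permutation′; _⟨$⟩ʳ_; _⟨$⟩ˡ_; _∘ₚ_; cast-id; insert; remove; inverseˡ; inverseʳ;
         insert-punchIn; insert-remove; remove-insert; punchIn-permute)
open import Data.Fin.Properties as Finₚ using (punchIn-injective; toℕ-cast; toℕ-injective; toℕ-↑ˡ)
open import Data.List.Base as List using (List; []; _∷_; [_]; filter)
import Data.List.Properties as Listₚ
import Data.List.Membership.Setoid as SetoidMembership
import Data.List.Membership.Setoid.Properties as Membershipₚ
import Data.List.Relation.Binary.Permutation.Setoid as SetoidPermutation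
import Data.List.Relation.Binary.Permutation.Setoid.Properties as SetoidPermutationₚ
open import Data.List.Relation.Unary.All as All using (All; []; _∷_)
open import Data.List.Relation.Unary.All.Properties using (All¬⇒¬Any; all-filter)
open import Data.List.Relation.Unary.AllPairs using ([]; _∷_)
open import Data.List.Relation.Unary.Any using (here; there)
open import Data.List.Relation.Unary.Unique.Setoid using (Unique)
import Data.List.Relation.Unary.Unique.Setoid.Properties as Uniqueₚ
open import Data.Nat.Base as ℕ using (ℕ; zero; suc; _+_; z<s; s<s)
open import Data.Nat.Properties as ℕₚ using (+-comm; +-suc; +-identityʳ)
open import Data.Product.Base using (_×_; _,_; proj₁; proj₂; ∃)
open import Data.Sum.Base as Sum using (_⊎_; inj₁; inj₂)
open import Data.Vec.Base using (Vec; []; _∷_; _++_; cast; lookup; tabulate)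
import Data.Vec.Properties as Vecₚ
open import Data.Vec.Relation.Binary.Pointwise.Inductive using (_∷_)
open import Function.Base using (_∘_)
open import Level using (Level; _⊔_)
open import Relation.Binary.Bundles using (Setoid)
open import Relation.Binary.Core using (_Preserves_⟶_)
open import Relation.Binary.Definitions using (_Respects_)
open import Relation.Binary.PropositionalEquality 
  using (_≡_; _≢_; refl; sym; trans; cong; cong₂; subst; subst₂; module ≡-Reasoning)
import Relation.Binary.Reasoning.Setoid as SetoidReasoning
open import Relation.Nullary.Decidable using (does; yes; no)
open import Relation.Nullary.Negation using (¬_; contradiction)
open import Relation.Unary using (Pred; Decidable; _∪_)

-- A (k,l)-shuffle whose first letter comes from the first (second) block is
-- obtained by prepending that letter to a unique (k-1,l)- (resp. (k,l-1)-)
-- shuffle, and a shuffle of two nonempty blocks lies in exactly one of sh≺ and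
-- sh≻.  So the sums over sh≺ and sh≻ satisfy the recursion that defines ≺ and
-- ≻.

private
  variable
    c ℓ r s : Level

-- Lists enumerating a predicate without repetition, up to a setoid equality.

record Enumerates (S : Setoid c ℓ) (P : Pred (Setoid.Carrier S) r) (xs : List (Setoid.Carrier S)) : Set (c ⊔ ℓ ⊔ r) where
  open SetoidMembership S using (_∈_)
  field
    unique   : Unique S xs
    sound    : ∀ {x} → x ∈ xs → P x
    complete : ∀ {x} → P x → x ∈ xs

module _ (S : Setoid c ℓ) where
  open Setoid S using (Carrier; _≈_) renaming (refl to ≈-refl; sym to ≈-sym; trans to ≈-trans)
  open SetoidMembership S using (_∈_)
  open SetoidPermutation S using (_↭_; ↭-refl; ↭-sym; ↭-trans; ↭-reflexive-≋; prep)
  open SetoidPermutationₚ S using (∈-resp-↭; Unique-resp-↭; ↭-shift)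
  open Membershipₚ using (∈-∃++; ∈-resp-≈)
  open Enumerates

  -- Induction on `xs`: its head matches some `z` in `ys`, and `z` is moved to the front. Since both
  -- lists are repetition-free, removing the two heads leaves lists that still have the same
  -- members.
  unique∧set⇒↭ : ∀ {xs ys} → Unique S xs → Unique S ys →
                 (∀ {x} → x ∈ xs → x ∈ ys) → (∀ {x} → x ∈ ys → x ∈ xs) → xs ↭ ys
  unique∧set⇒↭ {[]}     {[]}     _ _ _ _    = ↭-refl
  unique∧set⇒↭ {[]}     {y ∷ ys} _ _ _ ys⊆  = contradiction (ys⊆ (here ≈-refl)) λ ()
  unique∧set⇒↭ {x ∷ xs} {ys} (x∉ ∷ xs!) ys! xs⊆ ys⊆ with ∈-∃++ S (xs⊆ (here ≈-refl))
  ... | as , bs , z , x≈z , ys≋ with ↭-trans (↭-reflexive-≋ ys≋) (↭-shift as bs)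
  ...   | ys↭ with Unique-resp-↭ ys↭ ys!
  ...     | z∉ ∷ zs! = ↭-trans (prep x≈z (unique∧set⇒↭ xs! zs! to from)) (↭-sym ys↭)
    where
    to : ∀ {w} → w ∈ xs → w ∈ as List.++ bs
    to w∈xs with ∈-resp-↭ ys↭ (xs⊆ (there w∈xs))
    ... | here w≈z = contradiction (∈-resp-≈ S (≈-trans w≈z (≈-sym x≈z)) w∈xs) (All¬⇒¬Any x∉)
    ... | there w∈ = w∈
    from : ∀ {w} → w ∈ as List.++ bs → w ∈ xs
    from w∈ with ys⊆ (∈-resp-↭ (↭-sym ys↭) (there w∈))
    ... | here w≈x = contradiction (∈-resp-≈ S (≈-trans w≈x x≈z) w∈) (All¬⇒¬Any z∉)
    ... | there w∈xs = w∈xs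

  -- This is the source of every rearrangement of sums below: two descriptions of the same set of
  -- shuffles give lists that differ by reordering only.
  enumerations-↭ : {P : Pred Carrier r} {Q : Pred Carrier s} → (∀ x → P x → Q x) → (∀ x → Q x → P x) →
                   ∀ {xs ys} → Enumerates S P xs → Enumerates S Q ys → xs ↭ ys
  enumerations-↭ P⊆Q Q⊆P X Y = unique∧set⇒↭ (unique X) (unique Y)
    (λ {x} → complete Y ∘ P⊆Q x ∘ sound X) (λ {x} → complete X ∘ Q⊆P x ∘ sound Y)

  enumerates-singleton : {P : Pred Carrier r} → P Respects _≈_ → ∀ {x} → P x → (∀ y → P y → y ≈ x) → Enumerates S P [ x ]
  enumerates-singleton resp Px only = record
    { unique   = [] ∷ []
    ; sound    = λ { (here y≈x) → resp (≈-sym y≈x) Px }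
    ; complete = λ {y} Py → here (only y Py)
    }

  enumerates-++ : {P : Pred Carrier r} {Q : Pred Carrier s} → (∀ x → P x → ¬ Q x) →
                  ∀ {xs ys} → Enumerates S P xs → Enumerates S Q ys → Enumerates S (P ∪ Q) (xs List.++ ys)
  enumerates-++ disjoint {xs} X Y = record
    { unique   = Uniqueₚ.++⁺ S (unique X) (unique Y) λ { {x} (∈xs , ∈ys) → disjoint x (sound X ∈xs) (sound Y ∈ys) }
    ; sound    = λ ∈xs++ys → Sum.map (sound X) (sound Y) (Membershipₚ.∈-++⁻ S xs ∈xs++ys)
    ; complete = λ { (inj₁ Px) → Membershipₚ.∈-++⁺ˡ S (complete X Px)
                   ; (inj₂ Qx) → Membershipₚ.∈-++⁺ʳ S xs (complete Y Qx) }
    }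

module _ (S : Setoid c ℓ) (T : Setoid c ℓ) where
  private
    module S = Setoid S
    module T = Setoid T
  open Enumerates

  enumerates-map : {P : Pred S.Carrier r} {Q : Pred T.Carrier s} → Q Respects T._≈_ →
    (f : S.Carrier → T.Carrier) → f Preserves S._≈_ ⟶ T._≈_ → (∀ {x y} → f x T.≈ f y → x S.≈ y) →
    (∀ {x} → P x → Q (f x)) → (∀ {y} → Q y → ∃ λ x → P x × y T.≈ f x) →
    ∀ {xs} → Enumerates S P xs → Enumerates T Q (List.map f xs)
  enumerates-map resp f f-cong f-inj to from X = record
    { unique   = Uniqueₚ.map⁺ S T f-inj (unique X)
    ; sound    = λ y∈ → let x , x∈ , y≈ = Membershipₚ.∈-map⁻ S T y∈ in resp (T.sym y≈) (to (sound X x∈))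
    ; complete = λ Qy → let x , Px , y≈ = from Qy in
        Membershipₚ.∈-resp-≈ T (T.sym y≈) (Membershipₚ.∈-map⁺ S T f-cong (complete X Px))
    }

-- Permutations up to pointwise equality, and the shuffle predicates.

private
  variable
    k l m n : ℕ

-- `Perm.≈` compares forward maps only, whereas `permute` and the first-letter conditions read the
-- inverse.
⟨$⟩ˡ-cong : (σ τ : Permutation′ n) → σ Perm.≈ τ → ∀ i → σ ⟨$⟩ˡ i ≡ τ ⟨$⟩ˡ i
⟨$⟩ˡ-cong σ τ σ≈τ i = begin
  σ ⟨$⟩ˡ i                      ≡⟨ cong (σ ⟨$⟩ˡ_) (inverseʳ τ) ⟨
  σ ⟨$⟩ˡ (τ ⟨$⟩ʳ (τ ⟨$⟩ˡ i))    ≡⟨ cong (σ ⟨$⟩ˡ_) (σ≈τ _) ⟨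
  σ ⟨$⟩ˡ (σ ⟨$⟩ʳ (τ ⟨$⟩ˡ i))    ≡⟨ inverseˡ σ ⟩
  τ ⟨$⟩ˡ i                      ∎
  where open ≡-Reasoning

-- Away from `i`, a permutation is `remove i` followed by `punchIn` at its value there; the common
-- `punchIn` is then cancelled by injectivity.
remove-cong : ∀ i (σ τ : Permutation′ (suc n)) → σ Perm.≈ τ → remove i σ Perm.≈ remove i τ
remove-cong i σ τ σ≈τ j = punchIn-injective (σ ⟨$⟩ʳ i) _ _ (begin
  punchIn (σ ⟨$⟩ʳ i) (remove i σ ⟨$⟩ʳ j)  ≡⟨ punchIn-permute σ i j ⟨
  σ ⟨$⟩ʳ punchIn i j                      ≡⟨ σ≈τ _ ⟩
  τ ⟨$⟩ʳ punchIn i j                      ≡⟨ punchIn-permute τ i j ⟩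
  punchIn (τ ⟨$⟩ʳ i) (remove i τ ⟨$⟩ʳ j)  ≡⟨ cong (λ h → punchIn h (remove i τ ⟨$⟩ʳ j)) (σ≈τ i) ⟨
  punchIn (σ ⟨$⟩ʳ i) (remove i τ ⟨$⟩ʳ j)  ∎)
  where open ≡-Reasoning

insert-cong : ∀ i j (σ τ : Permutation′ n) → σ Perm.≈ τ → insert i j σ Perm.≈ insert i j τ
insert-cong i j σ τ σ≈τ k with i Finₚ.≟ k
... | yes _ = refl
... | no _  = cong (punchIn j) (σ≈τ _)

-- No later position takes the value `zero`, so `f` restricted to the positions `suc i` and lowered
-- by one is an increasing self-map of a smaller `Fin`, hence the identity by induction.
increasing-id : (f : Fin n → Fin n) → f Preserves Fin._<_ ⟶ Fin._<_ → ∀ i → f i ≡ i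
increasing-id {zero}  f f↑ ()
increasing-id {suc n} f f↑ = λ { zero → f-zero ; (suc i) → f-suc i }
  where
  f≢0 : ∀ i → zero ≢ f (suc i)
  f≢0 i 0≡f = contradiction (subst (f zero Fin.<_) (sym 0≡f) (f↑ {zero} {suc i} z<s)) λ ()
  suc-punchOut : ∀ {i : Fin (suc n)} (0≢i : zero ≢ i) → suc (Fin.punchOut 0≢i) ≡ i
  suc-punchOut = Finₚ.punchIn-punchOut
  f-suc : ∀ i → f (suc i) ≡ suc i
  f-suc i = trans (sym (suc-punchOut (f≢0 i))) (cong suc (increasing-id (λ j → Fin.punchOut (f≢0 j))
    (λ {j} {h} j<h → ℕ.s<s⁻¹ (subst₂ Fin._<_ (sym (suc-punchOut (f≢0 j))) (sym (suc-punchOut (f≢0 h))) (f↑ (s<s j<h)))) i))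
  f-zero : f zero ≡ zero
  f-zero with f zero in eq
  ... | zero  = refl
  -- By `f-suc`, the value `suc i` is already taken at `suc i`, where `f` must be strictly larger
  -- than at `zero`.
  ... | suc i = contradiction (f↑ {zero} {suc i} z<s) (ℕₚ.<-irrefl (cong toℕ (trans eq (sym (f-suc i)))))

IsShuffle-resp-≈ : ∀ k l → IsShuffle k l Respects Perm._≈_
IsShuffle-resp-≈ k l σ≈τ (σ↑ˡ , σ↑ʳ) =
  (λ i<j → subst₂ Fin._<_ (σ≈τ _) (σ≈τ _) (σ↑ˡ i<j)) ,
  (λ i<j → subst₂ Fin._<_ (σ≈τ _) (σ≈τ _) (σ↑ʳ i<j))

IsShuffle≺-resp-≈ : ∀ m n → IsShuffle≺ m n Respects Perm._≈_
IsShuffle≺-resp-≈ m n {σ} {τ} σ≈τ (shuffle , first) =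
  IsShuffle-resp-≈ (suc m) (suc n) {σ} {τ} σ≈τ shuffle , trans (sym (⟨$⟩ˡ-cong σ τ σ≈τ zero)) first

IsShuffle≻-resp-≈ : ∀ m n → IsShuffle≻ m n Respects Perm._≈_
IsShuffle≻-resp-≈ m n {σ} {τ} σ≈τ (shuffle , first) =
  IsShuffle-resp-≈ (suc m) (suc n) {σ} {τ} σ≈τ shuffle , trans (sym (⟨$⟩ˡ-cong σ τ σ≈τ zero)) first

-- Prepending the first letter of either block, and removing it.

consˡ : ∀ k l → Permutation′ (k + l) → Permutation′ (suc k + l)
consˡ k l = insert zero zero

-- The new letter sits at position `suc m`, after the whole first block, and receives the smallest
-- value. The casts are there because `suc m + suc l` does not reduce to `suc (suc m + l)`.
consʳ : ∀ m l → Permutation′ (suc m + l) → Permutation′ (suc m + suc l)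
consʳ m l ρ = insert (suc m ↑ʳ zero) zero (cast-id eq ∘ₚ ρ ∘ₚ cast-id (sym eq))
  where eq = +-suc m l

-- dropʳ m n is unconsʳ m (suc n); here the remaining second block may be empty.
unconsʳ : ∀ m l → Permutation′ (suc m + suc l) → Permutation′ (suc m + l)
unconsʳ m l σ = cast-id (sym eq) ∘ₚ remove (suc m ↑ʳ zero) σ ∘ₚ cast-id eq
  where eq = +-suc m l

consʳ-cong : ∀ m l (ρ τ : Permutation′ (suc m + l)) → ρ Perm.≈ τ → consʳ m l ρ Perm.≈ consʳ m l τ
consʳ-cong m l ρ τ ρ≈τ = insert-cong (suc m ↑ʳ zero) zero
  (cast-id eq ∘ₚ ρ ∘ₚ cast-id (sym eq)) (cast-id eq ∘ₚ τ ∘ₚ cast-id (sym eq))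
  (λ i → cong (Fin.cast (sym eq)) (ρ≈τ (Fin.cast eq i)))
  where eq = +-suc m l

unconsʳ-cong : ∀ m l (σ τ : Permutation′ (suc m + suc l)) → σ Perm.≈ τ → unconsʳ m l σ Perm.≈ unconsʳ m l τ
unconsʳ-cong m l σ τ σ≈τ i = cong (Fin.cast eq) (remove-cong (suc m ↑ʳ zero) σ τ σ≈τ (Fin.cast (sym eq) i))
  where eq = +-suc m l

unconsʳ-consʳ : ∀ m l ρ → unconsʳ m l (consʳ m l ρ) Perm.≈ ρ
unconsʳ-consʳ m l ρ i = begin
  Fin.cast eq (remove p (insert p zero τ) ⟨$⟩ʳ j)         ≡⟨ cong (Fin.cast eq) (remove-insert p zero τ j) ⟩
  Fin.cast eq (Fin.cast (sym eq) (ρ ⟨$⟩ʳ Fin.cast eq j))  ≡⟨ Finₚ.cast-involutive eq (sym eq) _ ⟩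
  ρ ⟨$⟩ʳ Fin.cast eq (Fin.cast (sym eq) i)                ≡⟨ cong (ρ ⟨$⟩ʳ_) (Finₚ.cast-involutive eq (sym eq) i) ⟩
  ρ ⟨$⟩ʳ i                                                ∎
  where
  open ≡-Reasoning
  eq = +-suc m l
  p = suc m ↑ʳ zero
  τ = cast-id eq ∘ₚ ρ ∘ₚ cast-id (sym eq)
  j = Fin.cast (sym eq) i

first⇒image : ∀ {p} (σ : Permutation′ (suc n)) → σ ⟨$⟩ˡ zero ≡ p → σ ⟨$⟩ʳ p ≡ zero
first⇒image σ refl = inverseʳ σ

-- `insert-remove` reinserts the letter with its old value, which the hypothesis on the inverse
-- forces to be `zero`.
consˡ-remove : ∀ k l (σ : Permutation′ (suc k + l)) → σ ⟨$⟩ˡ zero ≡ zero → consˡ k l (remove zero σ) Perm.≈ σ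
consˡ-remove k l σ first i = trans
  (cong (λ j → insert zero j (remove zero σ) ⟨$⟩ʳ i) (sym (first⇒image σ first)))
  (insert-remove zero σ i)

consʳ-unconsʳ : ∀ m l σ → σ ⟨$⟩ˡ zero ≡ suc m ↑ʳ zero → consʳ m l (unconsʳ m l σ) Perm.≈ σ
consʳ-unconsʳ m l σ first i = begin
  consʳ m l (unconsʳ m l σ) ⟨$⟩ʳ i            ≡⟨ insert-cong p zero (cast-id eq ∘ₚ unconsʳ m l σ ∘ₚ cast-id (sym eq)) (remove p σ) uncast i ⟩
  insert p zero (remove p σ) ⟨$⟩ʳ i           ≡⟨ cong (λ j → insert p j (remove p σ) ⟨$⟩ʳ i) (first⇒image σ first) ⟨
  insert p (σ ⟨$⟩ʳ p) (remove p σ) ⟨$⟩ʳ i     ≡⟨ insert-remove p σ i ⟩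
  σ ⟨$⟩ʳ i                                    ∎
  where
  open ≡-Reasoning
  eq = +-suc m l
  p = suc m ↑ʳ zero
  uncast : cast-id eq ∘ₚ unconsʳ m l σ ∘ₚ cast-id (sym eq) Perm.≈ remove p σ
  uncast j = trans (Finₚ.cast-involutive (sym eq) eq _)
    (cong (remove p σ ⟨$⟩ʳ_) (Finₚ.cast-involutive (sym eq) eq j))

-- The position in a word of its i-th letter other than the first of the second block.
skip : ∀ m l → Fin (suc m + l) → Fin (suc m + suc l)
skip m l i = punchIn (suc m ↑ʳ zero) (Fin.cast (sym (+-suc m l)) i)

skip-↑ˡ : ∀ m l (i : Fin (suc m)) → skip m l (i ↑ˡ l) ≡ i ↑ˡ suc l
skip-↑ˡ zero    l zero    = refl
skip-↑ˡ (suc m) l zero    = refl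
skip-↑ˡ (suc m) l (suc i) = cong suc (skip-↑ˡ m l i)

skip-↑ʳ : ∀ m l (j : Fin l) → skip m l (suc m ↑ʳ j) ≡ suc m ↑ʳ suc j
skip-↑ʳ zero    l j = cong (λ i → suc (suc i)) (Finₚ.cast-is-id refl j)
skip-↑ʳ (suc m) l j = cong suc (skip-↑ʳ m l j)

consʳ-skip : ∀ m l ρ i → consʳ m l ρ ⟨$⟩ʳ skip m l i ≡ suc (Fin.cast (sym (+-suc m l)) (ρ ⟨$⟩ʳ i))
consʳ-skip m l ρ i = trans
  (insert-punchIn (suc m ↑ʳ zero) zero (cast-id eq ∘ₚ ρ ∘ₚ cast-id (sym eq)) (Fin.cast (sym eq) i))
  (cong (λ j → suc (Fin.cast (sym eq) (ρ ⟨$⟩ʳ j))) (Finₚ.cast-involutive eq (sym eq) i))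
  where eq = +-suc m l

-- Under `toℕ` the cast disappears, and the order on `Fin` is the order of the underlying numbers,
-- so this form is enough to transport monotonicity.
consʳ-↑ˡ : ∀ m l ρ i → toℕ (consʳ m l ρ ⟨$⟩ʳ (i ↑ˡ suc l)) ≡ suc (toℕ (ρ ⟨$⟩ʳ (i ↑ˡ l)))
consʳ-↑ˡ m l ρ i = begin
  toℕ (consʳ m l ρ ⟨$⟩ʳ (i ↑ˡ suc l))                         ≡⟨ cong (λ j → toℕ (consʳ m l ρ ⟨$⟩ʳ j)) (skip-↑ˡ m l i) ⟨
  toℕ (consʳ m l ρ ⟨$⟩ʳ skip m l (i ↑ˡ l))                    ≡⟨ cong toℕ (consʳ-skip m l ρ (i ↑ˡ l)) ⟩
  suc (toℕ (Fin.cast (sym (+-suc m l)) (ρ ⟨$⟩ʳ (i ↑ˡ l))))    ≡⟨ cong suc (toℕ-cast _ (ρ ⟨$⟩ʳ (i ↑ˡ l))) ⟩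
  suc (toℕ (ρ ⟨$⟩ʳ (i ↑ˡ l)))                                 ∎
  where open ≡-Reasoning

consʳ-↑ʳ : ∀ m l ρ j → toℕ (consʳ m l ρ ⟨$⟩ʳ (suc m ↑ʳ suc j)) ≡ suc (toℕ (ρ ⟨$⟩ʳ (suc m ↑ʳ j)))
consʳ-↑ʳ m l ρ j = begin
  toℕ (consʳ m l ρ ⟨$⟩ʳ (suc m ↑ʳ suc j))                       ≡⟨ cong (λ i → toℕ (consʳ m l ρ ⟨$⟩ʳ i)) (skip-↑ʳ m l j) ⟨
  toℕ (consʳ m l ρ ⟨$⟩ʳ skip m l (suc m ↑ʳ j))                  ≡⟨ cong toℕ (consʳ-skip m l ρ (suc m ↑ʳ j)) ⟩
  suc (toℕ (Fin.cast (sym (+-suc m l)) (ρ ⟨$⟩ʳ (suc m ↑ʳ j))))  ≡⟨ cong suc (toℕ-cast _ (ρ ⟨$⟩ʳ (suc m ↑ʳ j))) ⟩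
  suc (toℕ (ρ ⟨$⟩ʳ (suc m ↑ʳ j)))                               ∎
  where open ≡-Reasoning

consʳ-first : ∀ m l ρ → consʳ m l ρ ⟨$⟩ʳ (suc m ↑ʳ zero) ≡ zero
consʳ-first m l ρ = first⇒image (consʳ m l ρ) refl

-- Prepending preserves and reflects the shuffle condition.

consˡ-shuffle⁺ : ∀ k l ρ → IsShuffle k l ρ → IsShuffle (suc k) l (consˡ k l ρ)
consˡ-shuffle⁺ k l ρ (ρ↑ˡ , ρ↑ʳ) = ↑ˡ-part , λ i<j → s<s (ρ↑ʳ i<j)
  where
  ↑ˡ-part : (λ i → consˡ k l ρ ⟨$⟩ʳ (i ↑ˡ l)) Preserves Fin._<_ ⟶ Fin._<_
  ↑ˡ-part {zero}  {suc j} _         = z<s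
  ↑ˡ-part {suc i} {suc j} (s<s i<j) = s<s (ρ↑ˡ i<j)

consˡ-shuffle⁻ : ∀ k l ρ → IsShuffle (suc k) l (consˡ k l ρ) → IsShuffle k l ρ
consˡ-shuffle⁻ k l ρ (σ↑ˡ , σ↑ʳ) = (λ i<j → ℕ.s<s⁻¹ (σ↑ˡ (s<s i<j))) , (λ i<j → ℕ.s<s⁻¹ (σ↑ʳ i<j))

consʳ-shuffle⁺ : ∀ m l ρ → IsShuffle (suc m) l ρ → IsShuffle (suc m) (suc l) (consʳ m l ρ)
consʳ-shuffle⁺ m l ρ (ρ↑ˡ , ρ↑ʳ) =
  (λ {i} {j} i<j → subst₂ ℕ._<_ (sym (consʳ-↑ˡ m l ρ i)) (sym (consʳ-↑ˡ m l ρ j)) (s<s (ρ↑ˡ i<j))) , ↑ʳ-part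
  where
  ↑ʳ-part : (λ j → consʳ m l ρ ⟨$⟩ʳ (suc m ↑ʳ j)) Preserves Fin._<_ ⟶ Fin._<_
  -- The only new comparisons involve the prepended letter: its value is `zero`, and all others have
  -- become successors.
  ↑ʳ-part {zero}  {suc j} _         = subst₂ ℕ._<_ (cong toℕ (sym (consʳ-first m l ρ))) (sym (consʳ-↑ʳ m l ρ j)) z<s
  ↑ʳ-part {suc i} {suc j} (s<s i<j) = subst₂ ℕ._<_ (sym (consʳ-↑ʳ m l ρ i)) (sym (consʳ-↑ʳ m l ρ j)) (s<s (ρ↑ʳ i<j))

consʳ-shuffle⁻ : ∀ m l ρ → IsShuffle (suc m) (suc l) (consʳ m l ρ) → IsShuffle (suc m) l ρ
consʳ-shuffle⁻ m l ρ (σ↑ˡ , σ↑ʳ) =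
  (λ {i} {j} i<j → ℕ.s<s⁻¹ (subst₂ ℕ._<_ (consʳ-↑ˡ m l ρ i) (consʳ-↑ˡ m l ρ j) (σ↑ˡ i<j))) ,
  (λ {i} {j} i<j → ℕ.s<s⁻¹ (subst₂ ℕ._<_ (consʳ-↑ʳ m l ρ i) (consʳ-↑ʳ m l ρ j) (σ↑ʳ (s<s i<j))))

-- Enumerating shuffles and decomposing them by their first letter.

shuffle-first : ∀ m n σ → IsShuffle (suc m) (suc n) σ → (σ ⟨$⟩ˡ zero ≡ zero) ⊎ (σ ⟨$⟩ˡ zero ≡ suc m ↑ʳ zero)
shuffle-first m n σ (σ↑ˡ , σ↑ʳ) with splitAt (suc m) {suc n} (σ ⟨$⟩ˡ zero) in eq
... | inj₁ zero    = inj₁ (sym (Finₚ.splitAt⁻¹-↑ˡ eq))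
-- If a later letter of a block had value `zero`, monotonicity would put the first letter of that
-- block strictly below `zero`.
... | inj₁ (suc i) = contradiction
  (subst (σ ⟨$⟩ʳ zero Fin.<_) (first⇒image σ (sym (Finₚ.splitAt⁻¹-↑ˡ eq))) (σ↑ˡ {zero} {suc i} z<s)) λ ()
... | inj₂ zero    = inj₂ (sym (Finₚ.splitAt⁻¹-↑ʳ eq))
... | inj₂ (suc j) = contradiction
  (subst (σ ⟨$⟩ʳ (suc m ↑ʳ zero) Fin.<_) (first⇒image σ (sym (Finₚ.splitAt⁻¹-↑ʳ {m = suc m} eq))) (σ↑ʳ {zero} {suc j} z<s)) λ ()

id-shuffle : ∀ k l → IsShuffle k l Perm.id
id-shuffle k l =
  (λ {i} {j} i<j → subst₂ ℕ._<_ (sym (toℕ-↑ˡ i l)) (sym (toℕ-↑ˡ j l)) i<j) ,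
  (λ {i} {j} i<j → subst₂ ℕ._<_ (sym (Finₚ.toℕ-↑ʳ k i)) (sym (Finₚ.toℕ-↑ʳ k j)) (ℕₚ.+-monoʳ-< k i<j))

shuffle₀ˡ≈id : ∀ l σ → IsShuffle 0 l σ → σ Perm.≈ Perm.id
shuffle₀ˡ≈id l σ (_ , σ↑ʳ) = increasing-id (σ ⟨$⟩ʳ_) σ↑ʳ

shuffle₀ʳ≈id : ∀ k σ → IsShuffle k 0 σ → σ Perm.≈ Perm.id
shuffle₀ʳ≈id k σ (σ↑ˡ , _) = increasing-id (σ ⟨$⟩ʳ_) λ {i} {j} i<j → subst₂ Fin._<_
  (cong (σ ⟨$⟩ʳ_) (restore i)) (cong (σ ⟨$⟩ʳ_) (restore j))
  (σ↑ˡ {Fin.cast k+0≡k i} {Fin.cast k+0≡k j} (subst₂ ℕ._<_ (sym (toℕ-cast _ i)) (sym (toℕ-cast _ j)) i<j))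
  where
  k+0≡k = +-identityʳ k
  -- `k + 0` does not reduce to `k`, so each position must first be recognised as one of the first
  -- block.
  restore : ∀ i → Fin.cast k+0≡k i ↑ˡ 0 ≡ i
  restore i = toℕ-injective (trans (toℕ-↑ˡ _ 0) (toℕ-cast _ i))

-- After one letter is removed, the rest may start with either block, and a block may have become
-- empty. Hence no condition on the first letter and no positivity of `k` or `l`.
shuffles : ∀ k l → List (Permutation′ (k + l))
shuffles k l = filter (isShuffle? k l) (permutations (k + l))

permutations-filter : {P : Pred (Permutation′ n) r} (P? : Decidable P) → P Respects Perm._≈_ →
                      Enumerates (Perm-setoid n) P (filter P? (permutations n))
permutations-filter {n = n} P? resp = record
  { unique   = Uniqueₚ.filter⁺ (Perm-setoid n) P? (permutations-unique n)
  ; sound    = λ σ∈ → proj₂ (Membershipₚ.∈-filter⁻ (Perm-setoid n) P? resp {xs = permutations n} σ∈)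
  ; complete = λ {σ} Pσ → Membershipₚ.∈-filter⁺ (Perm-setoid n) P? resp (permutations-complete σ) Pσ
  }

shuffles-enumerates : ∀ k l → Enumerates (Perm-setoid (k + l)) (IsShuffle k l) (shuffles k l)
shuffles-enumerates k l = permutations-filter (isShuffle? k l) (λ {σ} {τ} → IsShuffle-resp-≈ k l {σ} {τ})

sh≺-enumerates : ∀ m n → Enumerates (Perm-setoid (suc m + suc n)) (IsShuffle≺ m n) (sh≺ m n)
sh≺-enumerates m n = permutations-filter (isShuffle≺? m n) (λ {σ} {τ} → IsShuffle≺-resp-≈ m n {σ} {τ})

sh≻-enumerates : ∀ m n → Enumerates (Perm-setoid (suc m + suc n)) (IsShuffle≻ m n) (sh≻ m n)
sh≻-enumerates m n = permutations-filter (isShuffle≻? m n) (λ {σ} {τ} → IsShuffle≻-resp-≈ m n {σ} {τ})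

module _ {n : ℕ} where
  open SetoidPermutation (Perm-setoid n) public using () renaming (_↭_ to _↭ₚ_)

shuffles₀ˡ : ∀ l → shuffles 0 l ↭ₚ [ Perm.id ]
shuffles₀ˡ l = enumerations-↭ (Perm-setoid l) (λ _ P → P) (λ _ P → P) (shuffles-enumerates 0 l)
  (enumerates-singleton (Perm-setoid l) (λ {σ} {τ} → IsShuffle-resp-≈ 0 l {σ} {τ}) (id-shuffle 0 l) (shuffle₀ˡ≈id l))

shuffles₀ʳ : ∀ k → shuffles k 0 ↭ₚ [ Perm.id ]
shuffles₀ʳ k = enumerations-↭ (Perm-setoid (k + 0)) (λ _ P → P) (λ _ P → P) (shuffles-enumerates k 0)
  (enumerates-singleton (Perm-setoid (k + 0)) (λ {σ} {τ} → IsShuffle-resp-≈ k 0 {σ} {τ}) (id-shuffle k 0) (shuffle₀ʳ≈id k))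

shuffles-split : ∀ m n → shuffles (suc m) (suc n) ↭ₚ sh≺ m n List.++ sh≻ m n
shuffles-split m n = enumerations-↭ S to from (shuffles-enumerates (suc m) (suc n))
  (enumerates-++ S disjoint (sh≺-enumerates m n) (sh≻-enumerates m n))
  where
  S = Perm-setoid (suc m + suc n)
  to : ∀ σ → IsShuffle (suc m) (suc n) σ → IsShuffle≺ m n σ ⊎ IsShuffle≻ m n σ
  to σ shuffle = Sum.map (shuffle ,_) (shuffle ,_) (shuffle-first m n σ shuffle)
  from : ∀ σ → IsShuffle≺ m n σ ⊎ IsShuffle≻ m n σ → IsShuffle (suc m) (suc n) σ
  from σ = Sum.[ proj₁ , proj₁ ]
  disjoint : ∀ σ → IsShuffle≺ m n σ → ¬ IsShuffle≻ m n σ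
  disjoint σ (_ , first≺) (_ , first≻) = contradiction (trans (sym first≺) first≻) λ ()

sh≺-↭ : ∀ m n → sh≺ m n ↭ₚ List.map (consˡ m (suc n)) (shuffles m (suc n))
sh≺-↭ m n = enumerations-↭ T (λ _ P → P) (λ _ P → P) (sh≺-enumerates m n)
  (enumerates-map S T (λ {σ} {τ} → IsShuffle≺-resp-≈ m n {σ} {τ}) (consˡ m (suc n))
    (λ {σ} {τ} → insert-cong zero zero σ τ) (λ {σ} {τ} → injective {σ} {τ})
    -- The inverse of an inserted permutation computes to the insertion position at the inserted
    -- value, so the first-letter condition is `refl`.
    (λ {ρ} shuffle → consˡ-shuffle⁺ m (suc n) ρ shuffle , refl)
    (λ {σ} → from {σ}) (shuffles-enumerates m (suc n)))
  where
  S = Perm-setoid (m + suc n)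
  T = Perm-setoid (suc m + suc n)
  injective : ∀ {σ τ} → consˡ m (suc n) σ Perm.≈ consˡ m (suc n) τ → σ Perm.≈ τ
  injective eq i = Finₚ.suc-injective (eq (suc i))
  from : ∀ {σ} → IsShuffle≺ m n σ → ∃ λ ρ → IsShuffle m (suc n) ρ × σ Perm.≈ consˡ m (suc n) ρ
  from {σ} (shuffle , first) = remove zero σ ,
    consˡ-shuffle⁻ m (suc n) (remove zero σ)
      (IsShuffle-resp-≈ (suc m) (suc n) {σ} {consˡ m (suc n) (remove zero σ)} σ≈ shuffle) , σ≈
    where
    σ≈ : σ Perm.≈ consˡ m (suc n) (remove zero σ)
    σ≈ i = sym (consˡ-remove m (suc n) σ first i)

sh≻-↭ : ∀ m n → sh≻ m n ↭ₚ List.map (consʳ m n) (shuffles (suc m) n)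
sh≻-↭ m n = enumerations-↭ T (λ _ P → P) (λ _ P → P) (sh≻-enumerates m n)
  (enumerates-map S T (λ {σ} {τ} → IsShuffle≻-resp-≈ m n {σ} {τ}) (consʳ m n)
    (λ {σ} {τ} → consʳ-cong m n σ τ) (λ {σ} {τ} → injective {σ} {τ})
    (λ {ρ} shuffle → consʳ-shuffle⁺ m n ρ shuffle , refl)
    (λ {σ} → from {σ}) (shuffles-enumerates (suc m) n))
  where
  S = Perm-setoid (suc m + n)
  T = Perm-setoid (suc m + suc n)
  injective : ∀ {σ τ} → consʳ m n σ Perm.≈ consʳ m n τ → σ Perm.≈ τ
  injective {σ} {τ} eq i = begin
    σ ⟨$⟩ʳ i                          ≡⟨ unconsʳ-consʳ m n σ i ⟨
    unconsʳ m n (consʳ m n σ) ⟨$⟩ʳ i  ≡⟨ unconsʳ-cong m n (consʳ m n σ) (consʳ m n τ) eq i ⟩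
    unconsʳ m n (consʳ m n τ) ⟨$⟩ʳ i  ≡⟨ unconsʳ-consʳ m n τ i ⟩
    τ ⟨$⟩ʳ i                          ∎
    where open ≡-Reasoning
  from : ∀ {σ} → IsShuffle≻ m n σ → ∃ λ ρ → IsShuffle (suc m) n ρ × σ Perm.≈ consʳ m n ρ
  from {σ} (shuffle , first) = unconsʳ m n σ ,
    consʳ-shuffle⁻ m n (unconsʳ m n σ)
      (IsShuffle-resp-≈ (suc m) (suc n) {σ} {consʳ m n (unconsʳ m n σ)} σ≈ shuffle) , σ≈
    where
    σ≈ : σ Perm.≈ consʳ m n (unconsʳ m n σ)
    σ≈ i = sym (consʳ-unconsʳ m n σ first i)

-- The action of permutations on vectors.

permute-cong : {A : Set r} (σ τ : Permutation′ n) → σ Perm.≈ τ → (xs : Vec A n) → permute σ xs ≡ permute τ xs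
permute-cong σ τ σ≈τ xs = Vecₚ.tabulate-cong (λ i → cong (lookup xs) (⟨$⟩ˡ-cong σ τ σ≈τ i))

permute-id : {A : Set r} (xs : Vec A n) → permute Perm.id xs ≡ xs
permute-id = Vecₚ.tabulate∘lookup

lookup-skip : {A : Set r} (xs : Vec A (suc m)) (y : A) (ys : Vec A l) (i : Fin (suc m + l)) →
              lookup (xs ++ y ∷ ys) (skip m l i) ≡ lookup (xs ++ ys) i
lookup-skip {m = zero}  (x ∷ []) y ys zero    = refl
lookup-skip {m = zero}  (x ∷ []) y ys (suc i) = cong (lookup ys) (Finₚ.cast-is-id refl i)
lookup-skip {m = suc m} (x ∷ xs) y ys zero    = refl
lookup-skip {m = suc m} (x ∷ xs) y ys (suc i) = lookup-skip xs y ys i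

tabulate-cast : {A : Set r} (eq : m ≡ n) (f : Fin n → A) → tabulate (f ∘ Fin.cast eq) ≡ cast (sym eq) (tabulate f)
tabulate-cast refl f = trans (Vecₚ.tabulate-cong (λ i → cong f (Finₚ.cast-is-id refl i))) (sym (Vecₚ.cast-is-id refl _))

-- At `zero` the inverse of `consʳ m l ρ` is the position of `y`; at `suc i` it unfolds to a `skip`,
-- which jumps over `y`.
permute-consʳ : {A : Set r} (ρ : Permutation′ (suc m + l)) (xs : Vec A (suc m)) (y : A) (ys : Vec A l) →
  permute (consʳ m l ρ) (xs ++ y ∷ ys) ≡ cast (sym (+-suc (suc m) l)) (y ∷ permute ρ (xs ++ ys))
permute-consʳ {m = m} {l = l} ρ xs y ys = cong₂ _∷_ (Vecₚ.lookup-++ʳ xs (y ∷ ys) zero) (trans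
  (Vecₚ.tabulate-cong (λ i → lookup-skip xs y ys (ρ ⟨$⟩ˡ Fin.cast (+-suc m l) i)))
  (tabulate-cast (+-suc m l) (λ i → lookup (xs ++ ys) (ρ ⟨$⟩ˡ i))))

-- Base case for `succ`. The target cast is chosen to match the one in the base clause of `D≻`; the
-- equality argument of `cast` is irrelevant, so only its endpoints matter.
permute-consʳ-id : {A : Set r} (xs : Vec A (suc m)) (y : A) →
  permute (consʳ m 0 Perm.id) (xs ++ y ∷ []) ≡ cast (+-comm 1 (suc m)) (y ∷ xs)
permute-consʳ-id {m = m} xs y = begin
  permute (consʳ m 0 Perm.id) (xs ++ y ∷ [])             ≡⟨ permute-consʳ Perm.id xs y [] ⟩
  cast step (y ∷ permute Perm.id (xs ++ []))             ≡⟨ cong (λ zs → cast step (y ∷ zs)) (permute-id (xs ++ [])) ⟩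
  cast step (y ∷ (xs ++ []))                             ≡⟨ cong (λ zs → cast step (y ∷ zs)) (Vecₚ.cast-sym (+-identityʳ (suc m)) (Vecₚ.++-identityʳ-eqFree xs)) ⟨
  cast step (cast (cong suc (sym (+-identityʳ (suc m)))) (y ∷ xs))  ≡⟨ Vecₚ.cast-trans (cong suc (sym (+-identityʳ (suc m)))) step (y ∷ xs) ⟩
  cast (+-comm 1 (suc m)) (y ∷ xs)                       ∎
  where
  open ≡-Reasoning
  step = sym (+-suc (suc m) 0)

-- The decorations `D` along the prepending maps.

module _ {a ℓ} (Ω : ExtendedDiassociativeSemigroup a ℓ) where
  open ExtendedDiassociativeSemigroup Ω using (Carrier; _↼_; _⇀_; _◁_; _▷_)
  open Decorations Ω

  starts≺-cong : ∀ m n σ τ → σ Perm.≈ τ → starts≺ m n σ ≡ starts≺ m n τ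
  starts≺-cong m n σ τ σ≈τ = cong (λ i → does (i Finₚ.≟ zero)) (⟨$⟩ˡ-cong σ τ σ≈τ zero)

  -- Enumerations agree only up to `Perm.≈`, so the decoration must not depend on the
  -- representative. The proof follows the mutual recursion of `D`, `D≺` and `D≻`.
  D-cong  : ∀ m n σ τ → σ Perm.≈ τ → ∀ αs α βs → D m n σ αs α βs ≡ D m n τ αs α βs
  D≺-cong : ∀ m n σ τ → σ Perm.≈ τ → ∀ αs α βs → D≺ m n σ αs α βs ≡ D≺ m n τ αs α βs
  D≻-cong : ∀ m n σ τ → σ Perm.≈ τ → ∀ αs α βs → D≻ m n σ αs α βs ≡ D≻ m n τ αs α βs

  choose-cong : ∀ m n σ τ → σ Perm.≈ τ → ∀ β γ αs α α′ βs →
    (if starts≺ m n σ then β ∷ D m n σ αs α βs else γ ∷ D m n σ αs α′ βs) ≡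
    (if starts≺ m n τ then β ∷ D m n τ αs α βs else γ ∷ D m n τ αs α′ βs)
  choose-cong m n σ τ σ≈τ β γ αs α α′ βs = trans
    (if-cong (starts≺-cong m n σ τ σ≈τ))
    (if-cong₂ (starts≺ m n τ) (cong (β ∷_) (D-cong m n σ τ σ≈τ αs α βs)) (cong (γ ∷_) (D-cong m n σ τ σ≈τ αs α′ βs)))

  D-cong m n σ τ σ≈τ αs α βs = trans
    (if-cong (starts≺-cong m n σ τ σ≈τ))
    (if-cong₂ (starts≺ m n τ) (D≺-cong m n σ τ σ≈τ αs α βs) (D≻-cong m n σ τ σ≈τ αs α βs))
  D≺-cong zero    n σ τ σ≈τ []       α βs = refl
  D≺-cong (suc m) n σ τ σ≈τ (β ∷ αs) α βs =
    choose-cong m n (dropˡ m n σ) (dropˡ m n τ) (remove-cong zero σ τ σ≈τ) _ _ αs _ _ βs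
  D≻-cong m zero    σ τ σ≈τ αs α []       = refl
  D≻-cong m (suc n) σ τ σ≈τ αs α (β ∷ βs) = cong (cast _)
    (choose-cong m n (dropʳ m n σ) (dropʳ m n τ) (unconsʳ-cong m (suc n) σ τ σ≈τ) _ _ αs _ _ βs)

  -- The outer test on `consˡ` computes to `true`, exposing the recursive clause; what is left is
  -- that dropping the prepended letter gives back `ρ`, which holds only up to `Perm.≈`.
  D-consˡ : ∀ m n ρ β αs α βs → D (suc m) n (consˡ (suc m) (suc n) ρ) (β ∷ αs) α βs ≡
    (if starts≺ m n ρ then (β ↼ α) ∷ D m n ρ αs (β ◁ α) βs else (β ⇀ α) ∷ D m n ρ αs (β ▷ α) βs)
  D-consˡ m n ρ β αs α βs =
    choose-cong m n (dropˡ m n (consˡ (suc m) (suc n) ρ)) ρ (remove-insert zero zero ρ) _ _ αs _ _ βs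

  D-consʳ : ∀ m n ρ αs α β βs → D m (suc n) (consʳ m (suc n) ρ) αs α (β ∷ βs) ≡
    cast (sym (+-suc m (suc n)))
      (if starts≺ m n ρ then (α ↼ β) ∷ D m n ρ αs (α ◁ β) βs else (α ⇀ β) ∷ D m n ρ αs (α ▷ β) βs)
  D-consʳ m n ρ αs α β βs = cong (cast _)
    (choose-cong m n (dropʳ m n (consʳ m (suc n) ρ)) ρ (unconsʳ-consʳ m (suc n) ρ) _ _ αs _ _ βs)

  starts≺-true : ∀ m n σ → IsShuffle≺ m n σ → starts≺ m n σ ≡ true
  starts≺-true m n σ (_ , first) = cong (λ i → does (i Finₚ.≟ zero)) first

  starts≺-false : ∀ m n σ → IsShuffle≻ m n σ → starts≺ m n σ ≡ false
  starts≺-false m n σ (_ , first) = cong (λ i → does (i Finₚ.≟ zero)) first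

-- Finite sums of typed words.

module _ {c ℓ₁ ℓ₂ v ℓv o ℓo}
  (K : HeytingField c ℓ₁ ℓ₂) (V : VectorSpace K v ℓv) (Ω : ExtendedDiassociativeSemigroup o ℓo) where

  open TypedWords K V Ω
  open Decorations Ω using (starts≺)
  open Module Sh⁺ using (+ᴹ-isCommutativeMonoid; +ᴹ-identityʳ)
  open SetoidReasoning ≋-setoid
  private
    module Ω = ExtendedDiassociativeSemigroup Ω
    module V = Module V
    ≋-reflexive = Setoid.reflexive ≋-setoid
  open Ω using (_↼_; _⇀_; _◁_; _▷_)

  ⊗-cast : (eq : m ≡ n) {αs : Vec Ω.Carrier m} {βs : Vec Ω.Carrier n}
           {vs : Vec V.Carrierᴹ (suc m)} {ws : Vec V.Carrierᴹ (suc n)} →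
           βs ≡ cast eq αs → ws ≡ cast (cong suc eq) vs → βs ⊗ ws ≡ αs ⊗ vs
  ⊗-cast refl p q = cong₂ _⊗_ (trans p (Vecₚ.cast-is-id refl _)) (trans q (Vecₚ.cast-is-id refl _))

  ⟨∣⟩·-cong : ∀ α v {x y} → x ≋ y → ⟨ α ∣ v ⟩· x ≋ ⟨ α ∣ v ⟩· y
  ⟨∣⟩·-cong α v ≋-refl                    = ≋-refl
  ⟨∣⟩·-cong α v (≋-sym p)                 = ≋-sym (⟨∣⟩·-cong α v p)
  ⟨∣⟩·-cong α v (≋-trans p q)             = ≋-trans (⟨∣⟩·-cong α v p) (⟨∣⟩·-cong α v q)
  ⟨∣⟩·-cong α v (⊕-cong p q)              = ⊕-cong (⟨∣⟩·-cong α v p) (⟨∣⟩·-cong α v q)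
  ⟨∣⟩·-cong α v (⊙-cong p q)              = ⊙-cong p (⟨∣⟩·-cong α v q)
  ⟨∣⟩·-cong α v (⊕-assoc x y z)           = ⊕-assoc _ _ _
  ⟨∣⟩·-cong α v (⊕-comm x y)              = ⊕-comm _ _
  ⟨∣⟩·-cong α v (⊕-identityˡ x)           = ⊕-identityˡ _
  ⟨∣⟩·-cong α v (⊙-zeroˡ x)               = ⊙-zeroˡ _
  ⟨∣⟩·-cong α v (⊙-identityˡ x)           = ⊙-identityˡ _
  ⟨∣⟩·-cong α v (⊙-assoc a b x)           = ⊙-assoc a b _
  ⟨∣⟩·-cong α v (⊙-distribˡ a x y)        = ⊙-distribˡ a _ _
  ⟨∣⟩·-cong α v (⊙-distribʳ a b x)        = ⊙-distribʳ a b _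
  ⟨∣⟩·-cong α v (⊗-cong p q)              = ⊗-cong (Ω.refl ∷ p) (V.≈ᴹ-refl ∷ q)
  -- The prepended letter moves the linear slot from `i` to `suc i`.
  ⟨∣⟩·-cong α v (⊗-linear αs vs i a u w)  = ⊗-linear (α ∷ αs) (v ∷ vs) (suc i) a u w

  ∑-cong : {A : Set r} {xs : List A} {f g : A → Combination} → All (λ x → f x ≋ g x) xs → ∑ xs f ≋ ∑ xs g
  ∑-cong []       = ≋-refl
  ∑-cong (p ∷ ps) = ⊕-cong p (∑-cong ps)

  ∑-++ : {A : Set r} (xs ys : List A) (f : A → Combination) → ∑ (xs List.++ ys) f ≋ ∑ xs f ⊕ ∑ ys f
  ∑-++ List.[]       ys f = ≋-sym (⊕-identityˡ _)
  ∑-++ (x List.∷ xs) ys f = ≋-trans (⊕-cong ≋-refl (∑-++ xs ys f)) (≋-sym (⊕-assoc _ _ _))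

  ∑-map : {A : Set r} {B : Set s} (g : A → B) (xs : List A) (f : B → Combination) → ∑ (List.map g xs) f ≡ ∑ xs (f ∘ g)
  ∑-map g xs f = cong (List.foldr _⊕_ 𝟘) (sym (Listₚ.map-∘ xs))

  ⟨∣⟩·-∑ : {A : Set r} (α : Ω.Carrier) (v : V.Carrierᴹ) (xs : List A) (f : A → Combination) →
           ⟨ α ∣ v ⟩· ∑ xs f ≡ ∑ xs (λ x → ⟨ α ∣ v ⟩· f x)
  ⟨∣⟩·-∑ α v List.[]       f = refl
  ⟨∣⟩·-∑ α v (x List.∷ xs) f = cong (⟨ α ∣ v ⟩· f x ⊕_) (⟨∣⟩·-∑ α v xs f)

  ∑-↭ : {xs ys : List (Permutation′ n)} {f : Permutation′ n → Combination} →
        (∀ σ τ → σ Perm.≈ τ → f σ ≡ f τ) → xs ↭ₚ ys → ∑ xs f ≋ ∑ ys f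
  ∑-↭ {n = n} f-cong xs↭ys = SetoidPermutationₚ.foldr-commMonoid ≋-setoid +ᴹ-isCommutativeMonoid
    (SetoidPermutationₚ.map⁺ (Perm-setoid n) ≋-setoid (λ {σ} {τ} σ≈τ → ≋-reflexive (f-cong σ τ σ≈τ)) xs↭ys)

  -- Recursion for the shuffle sums.

  term : ∀ m n → Vec Ω.Carrier m → Ω.Carrier → Vec Ω.Carrier n → Vec V.Carrierᴹ (suc m + suc n) →
         Permutation′ (suc m + suc n) → Combination
  term m n αs α βs us σ = D m n σ αs α βs ⊗ permute σ us

  term-cong : ∀ m n αs α βs us σ τ → σ Perm.≈ τ → term m n αs α βs us σ ≡ term m n αs α βs us τ
  term-cong m n αs α βs us σ τ σ≈τ = cong₂ _⊗_ (D-cong Ω m n σ τ σ≈τ αs α βs) (permute-cong σ τ σ≈τ us)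

  -- The letters reduce to `u ∷ permute ρ us` by computation, so only the decoration needs an
  -- argument; the branch is then pulled out of the tensor.
  term-consˡ : ∀ m n ρ β αs α βs u us → term (suc m) n (β ∷ αs) α βs (u ∷ us) (consˡ (suc m) (suc n) ρ) ≡
    (if starts≺ m n ρ then ⟨ β ↼ α ∣ u ⟩· term m n αs (β ◁ α) βs us ρ else ⟨ β ⇀ α ∣ u ⟩· term m n αs (β ▷ α) βs us ρ)
  term-consˡ m n ρ β αs α βs u us = trans
    (cong (_⊗ (u ∷ permute ρ us)) (D-consˡ Ω m n ρ β αs α βs))
    (if-float (_⊗ (u ∷ permute ρ us)) (starts≺ m n ρ))

  term-consʳ : ∀ m n ρ αs α β βs vs w ws →
    term m (suc n) αs α (β ∷ βs) (vs ++ w ∷ ws) (consʳ m (suc n) ρ) ≡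
    (if starts≺ m n ρ then ⟨ α ↼ β ∣ w ⟩· term m n αs (α ◁ β) βs (vs ++ ws) ρ
                      else ⟨ α ⇀ β ∣ w ⟩· term m n αs (α ▷ β) βs (vs ++ ws) ρ)
  term-consʳ m n ρ αs α β βs vs w ws = trans
    (⊗-cast (sym (+-suc m (suc n))) {γs} {δs} {us} {xs} δs≡ xs≡) (if-float (_⊗ us) (starts≺ m n ρ))
    where
    γs = if starts≺ m n ρ then (α ↼ β) ∷ D m n ρ αs (α ◁ β) βs else (α ⇀ β) ∷ D m n ρ αs (α ▷ β) βs
    δs = D m (suc n) (consʳ m (suc n) ρ) αs α (β ∷ βs)
    us = w ∷ permute ρ (vs ++ ws)
    xs = permute (consʳ m (suc n) ρ) (vs ++ w ∷ ws)
    δs≡ : δs ≡ cast (sym (+-suc m (suc n))) γs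
    δs≡ = D-consʳ Ω m n ρ αs α β βs
    xs≡ : xs ≡ cast (cong suc (sym (+-suc m (suc n)))) us
    xs≡ = permute-consʳ ρ vs w ws

  -- Once the shuffles are split by first letter, the test `starts≺` is constant on each part, and
  -- the branching summand becomes two separate sums.
  ∑-shuffles : ∀ m n {f g h : Permutation′ (suc m + suc n) → Combination} → (∀ σ τ → σ Perm.≈ τ → f σ ≡ f τ) →
    (∀ σ → f σ ≡ (if starts≺ m n σ then g σ else h σ)) →
    ∑ (shuffles (suc m) (suc n)) f ≋ ∑ (sh≺ m n) g ⊕ ∑ (sh≻ m n) h
  ∑-shuffles m n {f} {g} {h} f-cong f≡ = begin
    ∑ (shuffles (suc m) (suc n)) f      ≈⟨ ∑-↭ f-cong (shuffles-split m n) ⟩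
    ∑ (sh≺ m n List.++ sh≻ m n) f       ≈⟨ ∑-++ (sh≺ m n) (sh≻ m n) f ⟩
    ∑ (sh≺ m n) f ⊕ ∑ (sh≻ m n) f       ≈⟨ ⊕-cong
      (∑-cong (All.map (λ {σ} σ≺ → ≋-reflexive (trans (f≡ σ) (if-cong (starts≺-true Ω m n σ σ≺)))) (all-filter (isShuffle≺? m n) (permutations (suc m + suc n)))))
      (∑-cong (All.map (λ {σ} σ≻ → ≋-reflexive (trans (f≡ σ) (if-cong (starts≺-false Ω m n σ σ≻)))) (all-filter (isShuffle≻? m n) (permutations (suc m + suc n))))) ⟩
    ∑ (sh≺ m n) g ⊕ ∑ (sh≻ m n) h       ∎

  ∑-sh≺ : ∀ m n {f} → (∀ σ τ → σ Perm.≈ τ → f σ ≡ f τ) →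
          ∑ (sh≺ m n) f ≋ ∑ (shuffles m (suc n)) (f ∘ consˡ m (suc n))
  ∑-sh≺ m n {f} f-cong = begin
    ∑ (sh≺ m n) f                                             ≈⟨ ∑-↭ f-cong (sh≺-↭ m n) ⟩
    ∑ (List.map (consˡ m (suc n)) (shuffles m (suc n))) f     ≡⟨ ∑-map (consˡ m (suc n)) (shuffles m (suc n)) f ⟩
    ∑ (shuffles m (suc n)) (f ∘ consˡ m (suc n))              ∎

  ∑-sh≻ : ∀ m n {f} → (∀ σ τ → σ Perm.≈ τ → f σ ≡ f τ) →
          ∑ (sh≻ m n) f ≋ ∑ (shuffles (suc m) n) (f ∘ consʳ m n)
  ∑-sh≻ m n {f} f-cong = begin
    ∑ (sh≻ m n) f                                     ≈⟨ ∑-↭ f-cong (sh≻-↭ m n) ⟩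
    ∑ (List.map (consʳ m n) (shuffles (suc m) n)) f   ≡⟨ ∑-map (consʳ m n) (shuffles (suc m) n) f ⟩
    ∑ (shuffles (suc m) n) (f ∘ consʳ m n)            ∎

  -- Mutual induction along the recursion of `prec` and `succ`: each call removes one letter, from
  -- the first block in `prec` and from the second in `succ`.
  prec-∑ : ∀ m n αs vs α βs ws → prec {m} {n} αs vs α βs ws ≋ ∑ (sh≺ m n) (term m n αs α βs (vs ++ ws))
  succ-∑ : ∀ m n αs vs α βs ws → succ {m} {n} αs vs α βs ws ≋ ∑ (sh≻ m n) (term m n αs α βs (vs ++ ws))

  ⟨∣⟩·-both : ∀ m n {α α′} v αs vs β β′ βs ws →
    ⟨ α ∣ v ⟩· prec αs vs β βs ws ⊕ ⟨ α′ ∣ v ⟩· succ αs vs β′ βs ws ≋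
    ∑ (sh≺ m n) (λ σ → ⟨ α ∣ v ⟩· term m n αs β βs (vs ++ ws) σ) ⊕
    ∑ (sh≻ m n) (λ σ → ⟨ α′ ∣ v ⟩· term m n αs β′ βs (vs ++ ws) σ)
  ⟨∣⟩·-both m n {α} {α′} v αs vs β β′ βs ws = begin
    ⟨ α ∣ v ⟩· prec αs vs β βs ws ⊕ ⟨ α′ ∣ v ⟩· succ αs vs β′ βs ws
      ≈⟨ ⊕-cong (⟨∣⟩·-cong α v (prec-∑ m n αs vs β βs ws)) (⟨∣⟩·-cong α′ v (succ-∑ m n αs vs β′ βs ws)) ⟩
    ⟨ α ∣ v ⟩· ∑ (sh≺ m n) (term m n αs β βs (vs ++ ws)) ⊕ ⟨ α′ ∣ v ⟩· ∑ (sh≻ m n) (term m n αs β′ βs (vs ++ ws))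
      ≡⟨ cong₂ _⊕_ (⟨∣⟩·-∑ α v (sh≺ m n) _) (⟨∣⟩·-∑ α′ v (sh≻ m n) _) ⟩
    ∑ (sh≺ m n) (λ σ → ⟨ α ∣ v ⟩· term m n αs β βs (vs ++ ws) σ) ⊕
    ∑ (sh≻ m n) (λ σ → ⟨ α′ ∣ v ⟩· term m n αs β′ βs (vs ++ ws) σ)
      ∎

  prec-∑ zero n [] (v ∷ []) α βs ws = ≋-sym (begin
    ∑ (sh≺ 0 n) t                                 ≈⟨ ∑-sh≺ 0 n t-cong ⟩
    -- The rest of the first block is empty, so the identity is the only shuffle left to prepend to.
    ∑ (shuffles 0 (suc n)) (t ∘ consˡ 0 (suc n))  ≈⟨ ∑-↭ (λ σ τ σ≈τ → t-cong (consˡ 0 (suc n) σ) (consˡ 0 (suc n) τ) (insert-cong zero zero σ τ σ≈τ)) (shuffles₀ˡ (suc n)) ⟩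
    t (consˡ 0 (suc n) Perm.id) ⊕ 𝟘               ≈⟨ +ᴹ-identityʳ _ ⟩
    (α ∷ βs) ⊗ (v ∷ permute Perm.id ws)           ≡⟨ cong (λ us → (α ∷ βs) ⊗ (v ∷ us)) (permute-id ws) ⟩
    (α ∷ βs) ⊗ (v ∷ ws)                           ∎)
    where
    t = term 0 n [] α βs (v ∷ ws)
    t-cong = term-cong 0 n [] α βs (v ∷ ws)
  -- Both sides meet in a sum over `sh≺ m n` plus a sum over `sh≻ m n`: the left by the induction
  -- hypotheses, the right by stripping `v` and splitting the remaining shuffles.
  prec-∑ (suc m) n (β ∷ αs) (v ∷ vs) α βs ws = ≋-trans
    (⟨∣⟩·-both m n v αs vs (β ◁ α) (β ▷ α) βs ws)
    (≋-sym (≋-trans (∑-sh≺ (suc m) n t-cong)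
      (∑-shuffles m n (λ σ τ σ≈τ → t-cong (consˡ (suc m) (suc n) σ) (consˡ (suc m) (suc n) τ) (insert-cong zero zero σ τ σ≈τ))
        (λ ρ → term-consˡ m n ρ β αs α βs v (vs ++ ws)))))
    where t-cong = term-cong (suc m) n (β ∷ αs) α βs (v ∷ vs ++ ws)
  succ-∑ m zero αs vs α [] (w ∷ []) = ≋-sym (begin
    ∑ (sh≻ m 0) t                                                             ≈⟨ ∑-sh≻ m 0 t-cong ⟩
    ∑ (shuffles (suc m) 0) (t ∘ consʳ m 0)                                    ≈⟨ ∑-↭ (λ σ τ σ≈τ → t-cong (consʳ m 0 σ) (consʳ m 0 τ) (consʳ-cong m 0 σ τ σ≈τ)) (shuffles₀ʳ (suc m)) ⟩
    t (consʳ m 0 Perm.id) ⊕ 𝟘                                                 ≈⟨ +ᴹ-identityʳ _ ⟩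
    -- Moving the single letter `w` in front rotates decorations and letters alike, each up to a
    -- cast between the same lengths.
    cast (+-comm 1 m) (α ∷ αs) ⊗ permute (consʳ m 0 Perm.id) (vs ++ w ∷ [])   ≡⟨ ⊗-cast (+-comm 1 m) refl (permute-consʳ-id vs w) ⟩
    (α ∷ αs) ⊗ (w ∷ vs)                                                       ∎)
    where
    t = term m 0 αs α [] (vs ++ w ∷ [])
    t-cong = term-cong m 0 αs α [] (vs ++ w ∷ [])
  succ-∑ m (suc n) αs vs α (β ∷ βs) (w ∷ ws) = ≋-trans
    (⟨∣⟩·-both m n w αs vs (α ◁ β) (α ▷ β) βs ws)
    (≋-sym (≋-trans (∑-sh≻ m (suc n) t-cong)
      (∑-shuffles m n (λ σ τ σ≈τ → t-cong (consʳ m (suc n) σ) (consʳ m (suc n) τ) (consʳ-cong m (suc n) σ τ σ≈τ))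
        (λ ρ → term-consʳ m n ρ αs α β βs vs w ws))))
    where t-cong = term-cong m (suc n) αs α (β ∷ βs) (vs ++ w ∷ ws)

proposition36 : ∀ {c ℓ₁ ℓ₂ v ℓv o ℓo} (K : HeytingField c ℓ₁ ℓ₂) (V : VectorSpace K v ℓv) (Ω : ExtendedDiassociativeSemigroup o ℓo) →
    let open TypedWords K V Ω
        open Module Sh⁺ using (_≈ᴹ_)
        Ω₀ = ExtendedDiassociativeSemigroup.Carrier Ω
        V₀ = Module.Carrierᴹ V
    in
    ∀ (m n : ℕ) (αs : Vec Ω₀ m) (α : Ω₀) (βs : Vec Ω₀ n) (vs : Vec V₀ (suc m)) (ws : Vec V₀ (suc n)) →
    (((αs ⊗ vs) ≺[ α ] (βs ⊗ ws)) ≈ᴹ ∑[ σ ∈ sh≺ m n ] (D m n σ αs α βs ⊗ permute σ (vs ++ ws))) ×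
    (((αs ⊗ vs) ≻[ α ] (βs ⊗ ws)) ≈ᴹ ∑[ σ ∈ sh≻ m n ] (D m n σ αs α βs ⊗ permute σ (vs ++ ws)))
-- On single typed words `extend` computes, so the products are literally `prec` and `succ`.
proposition36 K V Ω m n αs α βs vs ws = prec-∑ K V Ω m n αs vs α βs ws , succ-∑ K V Ω m n αs vs α βs ws
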